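{- The Finite Sums matrix ${\bf F}$ is maximal among rapidly image partition regular matrices with integer entries. That is, ${\bf F}$ is rapidly image partition regular, and whenever $\vec r\in\mathbb Z^\omega$ is a row with only finitely many nonzero entries which is not a row of ${\bf F}$, the matrix $\left(\begin{array}{c}\vec r\\ {\bf F}\end{array}\right)$ (obtained by adjoining $\vec r$ to ${\bf F}$ as an extra row) is not rapidly image partition regular.
   Context: $\mathbb N=\{1,2,3,\ldots\}$, $\omega=\{0,1,2,\ldots\}$. All matrices have only finitely many nonzero entries in each row. The Finite Sums matrix ${\bf F}$ is the $\omega\times\omega$ matrix with all entries $f_{i,j}\in\{0,1\}$ such that for each $i<\omega$, $\sum_{j=0}^\infty f_{i,j}2^j=i+1$; so its rows are exactly the nonzero sequences in $\{0,1\}^\omega$ with finitely many $1$'s. Let $u,v\in\mathbb N\cup\{\omega\}$. A $u\times v$ matrix $A$ with rational entries is rapidly image partition regular if and only if whenever $\mathbb N$ is finitely coloured and $p$ is a prime, there exists $\vec x=\langle x_i\rangle_{i<v}\in\mathbb N^v$ such that the entries of $A\vec x$ are monochromatic (all entries are natural numbers of the same colour) and, whenever $i+1<v$ and $s\in\omega$, if $p^s\leq x_i$ then $p^{s+8}$ divides $x_{i+1}$. -}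

module Defs where

open import Algebra.Definitions.RawMonoid using (sum)
open import Algebra.Properties.Monoid.Sum using (sum-cong-≗)
open import Data.Fin.Base using (Fin; zero; suc; toℕ)
open import Data.Integer.Base using (ℤ; 0ℤ; +_)
open import Data.Nat.Base as ℕ
  using (ℕ; zero; suc; _+_; _*_; _^_; _≤_; _<_; z≤n; s≤s; NonZero)
open import Data.Nat.DivMod using (_/_; _%_; m%n<n; m/n<m; m≡m%n+[m/n]*n)
open import Data.Nat.Divisibility using (_∣_)
open import Data.Nat.Primality using (Prime)
import Data.Nat.Properties as ℕₚ
open import Data.Product.Base using (∃-syntax; _×_; _,_)
open import Data.Rational.Base as ℚ using (ℚ; 0ℚ)
open import Data.Refinement using (Refinement-syntax; value)
open import Function.Base using (_∘_)
open import Relation.Binary.PropositionalEquality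
  using (_≡_; refl; sym; cong; cong₂; module ≡-Reasoning)

ℕ⁺ : Set
ℕ⁺ = [ n ∈ ℕ ∣ NonZero n ]

------------------------------------------------------------------------
-- Matrices of size u × v with u , v ∈ {1, 2, 3, …} ∪ {ω}

data Size : Set where
  fin : ℕ⁺ → Size
  ω   : Size

Index : Size → Set
Index (fin n) = Fin (value n)
Index ω       = ℕ

position : ∀ {v} → Index v → ℕ
position {fin _} i = toℕ i
position {ω}     i = i

-- Automatic when v is finite.
FinitelyNonzero : ∀ {A : Set} → A → ∀ {v} → (Index v → A) → Set
FinitelyNonzero 0# {v} a =
  ∃[ N ] ((i : Index v) → N ≤ position {v} i → a i ≡ 0#)

record Row (v : Size) : Set where
  constructor row
  field
    entry           : Index v → ℚ
    finitelyNonzero : FinitelyNonzero 0ℚ {v} entry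

open Row public

Matrix : Size → Size → Set
Matrix u v = Index u → Row v

fromℤ : ℤ → ℚ
fromℤ i = i ℚ./ 1

integerRow : ∀ {v} (a : Index v → ℤ) → FinitelyNonzero 0ℤ {v} a → Row v
integerRow a (N , a≡0) =
  row (fromℤ ∘ a) (N , λ i N≤i → cong fromℤ (a≡0 i N≤i))

fromℕ⁺ : ℕ⁺ → ℚ
fromℕ⁺ n = fromℤ (+ value n)

-- An infinite row is summed over an initial segment outside of which it
-- vanishes; the result does not depend on which one.
_·_ : ∀ {v} → Row v → (Index v → ℕ⁺) → ℚ
_·_ {fin _} a x = sum ℚ.+-0-rawMonoid (λ i → entry a i ℚ.* fromℕ⁺ (x i))
_·_ {ω} (row a (N , _)) x =
  sum ℚ.+-0-rawMonoid {N} (λ i → a (toℕ i) ℚ.* fromℕ⁺ (x (toℕ i)))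

-- The matrix whose row 0 is r, followed by the rows of A.
adjoin : ∀ {v} → Row v → Matrix ω v → Matrix ω v
adjoin r A zero    = r
adjoin r A (suc i) = A i

------------------------------------------------------------------------
-- Rapid image partition regularity

Monochromatic : ∀ {u k} → (ℕ⁺ → Fin k) → (Index u → ℚ) → Set
Monochromatic {u} χ y =
  ∃[ c ] ((i : Index u) → ∃[ n ] (y i ≡ fromℕ⁺ n × χ n ≡ c))

Rapid : ∀ {v} → ℕ → (Index v → ℕ⁺) → Set
Rapid {v} p x =
  (i j : Index v) → position {v} j ≡ suc (position {v} i) →
  ∀ s → p ^ s ≤ value (x i) → p ^ (s + 8) ∣ value (x j)

RapidlyImagePartitionRegular : ∀ {u v} → Matrix u v → Set
RapidlyImagePartitionRegular {u} {v} A =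
  ∀ k (χ : ℕ⁺ → Fin k) p → Prime p →
  ∃[ x ] (Monochromatic {u} χ (λ i → A i · x) × Rapid {v} p x)

------------------------------------------------------------------------
-- The Finite Sums matrix

binaryDigit : ℕ → ℕ → ℕ
binaryDigit n zero    = n % 2
binaryDigit n (suc j) = binaryDigit (n / 2) j

f : ℕ → ℕ → ℕ
f i j = binaryDigit (suc i) j

private
  half≤ : ∀ n j → n ≤ suc j → n / 2 ≤ j
  half≤ zero    j _     = z≤n
  half≤ (suc n) j 1+n≤1+j =
    ℕₚ.≤-pred (ℕₚ.<-≤-trans (m/n<m (suc n) 2 (s≤s (s≤s z≤n))) 1+n≤1+j)

  digit<2 : ∀ n j → binaryDigit n j < 2
  digit<2 n zero    = m%n<n n 2
  digit<2 n (suc j) = digit<2 (n / 2) j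

  digit≡0 : ∀ n j → n ≤ j → binaryDigit n j ≡ 0
  digit≡0 zero zero    _   = refl
  digit≡0 n    (suc j) n≤j = digit≡0 (n / 2) j (half≤ n j n≤j)

  digit-sum : ∀ N n c → n ≤ N →
    sum ℕ.+-0-rawMonoid {N} (λ j → binaryDigit n (toℕ j) * (c * 2 ^ toℕ j))
      ≡ n * c
  digit-sum zero    zero c _   = refl
  digit-sum (suc N) n    c n≤N = begin
    n % 2 * (c * 1) + sum ℕ.+-0-rawMonoid {N}
      (λ j → binaryDigit (n / 2) (toℕ j) * (c * (2 * 2 ^ toℕ j)))
      ≡⟨ cong₂ _+_ (cong (n % 2 *_) (ℕₚ.*-identityʳ c))
           (sum-cong-≗ ℕₚ.+-0-monoid {N}
             (λ j → cong (binaryDigit (n / 2) (toℕ j) *_)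
                      (sym (ℕₚ.*-assoc c 2 (2 ^ toℕ j))))) ⟩
    n % 2 * c + sum ℕ.+-0-rawMonoid {N}
      (λ j → binaryDigit (n / 2) (toℕ j) * (c * 2 * 2 ^ toℕ j))
      ≡⟨ cong ((n % 2 * c) ℕ.+_) (digit-sum N (n / 2) (c * 2) (half≤ n N n≤N)) ⟩
    n % 2 * c + n / 2 * (c * 2)
      ≡⟨ cong (λ t → n % 2 * c + n / 2 * t) (ℕₚ.*-comm c 2) ⟩
    n % 2 * c + n / 2 * (2 * c)
      ≡⟨ cong ((n % 2 * c) ℕ.+_) (sym (ℕₚ.*-assoc (n / 2) 2 c)) ⟩
    n % 2 * c + n / 2 * 2 * c
      ≡⟨ sym (ℕₚ.*-distribʳ-+ c (n % 2) (n / 2 * 2)) ⟩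
    (n % 2 + n / 2 * 2) * c
      ≡⟨ cong (_* c) (sym (m≡m%n+[m/n]*n n 2)) ⟩
    n * c ∎
    where open ≡-Reasoning

-- f-binary, f-vanishes and f-sum together say that the f i j lie in {0 , 1}
-- and that Σ_{j < ∞} f i j 2ʲ = i + 1, which determines them uniquely.
f-binary : ∀ i j → f i j < 2
f-binary i j = digit<2 (suc i) j

f-vanishes : ∀ i j → suc i ≤ j → f i j ≡ 0
f-vanishes i j = digit≡0 (suc i) j

f-sum : ∀ i →
  sum ℕ.+-0-rawMonoid {suc i} (λ j → f i (toℕ j) * 2 ^ toℕ j) ≡ suc i
f-sum i = begin
  sum ℕ.+-0-rawMonoid {suc i} (λ j → f i (toℕ j) * 2 ^ toℕ j)
    ≡⟨ sum-cong-≗ ℕₚ.+-0-monoid {suc i}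
         (λ j → cong (f i (toℕ j) *_) (sym (ℕₚ.*-identityˡ (2 ^ toℕ j)))) ⟩
  sum ℕ.+-0-rawMonoid {suc i} (λ j → f i (toℕ j) * (1 * 2 ^ toℕ j))
    ≡⟨ digit-sum (suc i) (suc i) 1 ℕₚ.≤-refl ⟩
  suc i * 1
    ≡⟨ ℕₚ.*-identityʳ (suc i) ⟩
  suc i ∎
  where open ≡-Reasoning

F : Matrix ω ω
F i = integerRow (λ j → + f i j)
        (suc i , λ j 1+i≤j → cong +_ (f-vanishes i j 1+i≤j))

module Submission where

-- F is rapidly image partition regular because, by Hindman's theorem (Baumgartner's
-- proof), the sequence t ↦ p^(9t) has a sequence of successive block sums all of whose
-- finite sums get the same colour.
--
-- Conversely, let r not be a row of F, let c* be its first coefficient outside {0 , 1}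
-- (if there is none, r = 0), and write integers in balanced base p for a prime p which
-- is large compared with the coefficients of r.  Rapidity makes the digits of the
-- terms of Σ r j x j disjoint.  Colour n by its lowest nonzero digit ℓ, by the pair T
-- of its two highest digits, and by the residues modulo N + 1 of #(c n) for c = 1 and
-- c = r 0, …, r (N − 1), where # counts the occurrences of T (which is not shared by
-- c n for c ≠ 1) followed, after zeros, by the lowest digit that c* n has.  In a
-- monochromatic solution, comparing x 0 + x 1 with x 0 and x 1 gives #(c x j) ≡ 0.
-- Hence #(Σ r j x j) ≡ 0 as well; but it is congruent to the number of borders between
-- a term with coefficient 1 and one with coefficient c*.  That number is at most N,
-- and positive unless c* is the first nonzero coefficient of r, in which case the
-- lowest digit is wrong.

open import Defs
open import Algebra.Definitions using (Associative)
open import Algebra.Definitions.RawMonoid using (sum)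
open import Axiom.ExcludedMiddle using (ExcludedMiddle)
open import Data.Bool.Base using (true; false; if_then_else_; _∧_)
open import Data.Empty using (⊥; ⊥-elim)
open import Data.Fin.Base as Fin using (Fin; toℕ; fromℕ<; combine; funToFin; finToFun)
import Data.Fin.Properties as Finₚ
open import Data.Integer.Base as ℤ using (ℤ; 0ℤ; 1ℤ; +_; -[1+_])
open import Data.Integer.DivMod using (_%ℕ_; _/ℕ_; n%ℕd<d; a≡a%ℕn+[a/ℕn]*n)
import Data.Integer.Properties as ℤₚ
open import Data.Integer.Tactic.RingSolver using (solve-∀)
open import Data.Irrelevant using ([_])
open import Data.List.Base using (List; []; _∷_; _++_; map; allFin)
open import Data.List.Membership.Propositional using (_∈_; lose)
open import Data.List.Membership.Propositional.Properties
  using (∈-++⁺ˡ; ∈-++⁺ʳ; ∈-map⁺; ∈-allFin)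
open import Data.List.Relation.Unary.All as All using (All; []; _∷_)
import Data.List.Relation.Unary.All.Properties as Allₚ
open import Data.List.Relation.Unary.Any using (Any; here; there)
open import Data.Nat.Base
import Data.Nat.Coprimality as Coprime
open import Data.Nat.DivMod
open import Data.Nat.Divisibility
open import Data.Nat.ListAction using (product)
open import Data.Nat.Primality
  using (Prime; prime⇒nonTrivial; prime⇒nonZero; prime⇒irreducible; euclidsLemma;
         ¬prime[1]; prime[2])
open import Data.Nat.Primality.Factorisation using (factorise)
open import Data.Nat.Properties
open import Data.Nat.Solver using (module +-*-Solver)
open import Data.Product.Base
  using (Σ-syntax; ∃-syntax; ∃₂; _×_; _,_; proj₁; proj₂; map₂)
open import Data.Product.Properties using (≡-dec)
open import Data.Rational.Base as ℚ using (mkℚ)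
import Data.Rational.Properties as ℚₚ
open import Data.Rational.Unnormalised.Base using (mkℚᵘ; *≡*)
open import Data.Refinement using (value) renaming (_,_ to _,ᵣ_)
open import Data.Refinement.Properties using (value-injective)
open import Data.Sum.Base using (_⊎_; inj₁; inj₂; [_,_]′)
open import Data.Unit.Base using (⊤; tt)
open import Function.Base using (_∘_; id)
open import Level using (0ℓ)
open import Relation.Binary.PropositionalEquality
open import Relation.Nullary using (¬_; yes; no; contradiction; does)
open import Relation.Nullary.Decidable using (dec-true; dec-false)

-- Hindman's theorem

module FiniteSums {A : Set} (_∙_ : A → A → A) (assoc : Associative _≡_ _∙_) where

  -- Sum x a b s : s is the sum of the x i over a nonempty set of indices
  -- a ≤ i < b, in increasing order.
  data Sum (x : ℕ → A) (a : ℕ) : ℕ → A → Set where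
    single : ∀ {b i} → a ≤ i → i < b → Sum x a b (x i)
    snoc   : ∀ {b i s} → Sum x a i s → i < b → Sum x a b (s ∙ x i)

  FS : (ℕ → A) → A → Set
  FS x s = ∃₂ λ a b → Sum x a b s

  Sum-nonempty : ∀ {x a b s} → Sum x a b s → a < b
  Sum-nonempty (single a≤i i<b) = ≤-<-trans a≤i i<b
  Sum-nonempty (snoc s i<b)     = <-trans (Sum-nonempty s) i<b

  Sum-lower : ∀ {x a a′ b s} → a′ ≤ a → Sum x a b s → Sum x a′ b s
  Sum-lower a′≤a (single a≤i i<b) = single (≤-trans a′≤a a≤i) i<b
  Sum-lower a′≤a (snoc s i<b)     = snoc (Sum-lower a′≤a s) i<b

  Sum-upper : ∀ {x a b b′ s} → b ≤ b′ → Sum x a b s → Sum x a b′ s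
  Sum-upper b≤b′ (single a≤i i<b) = single a≤i (<-≤-trans i<b b≤b′)
  Sum-upper b≤b′ (snoc s i<b)     = snoc s (<-≤-trans i<b b≤b′)

  Sum-++ : ∀ {x a b c s t} → Sum x a b s → Sum x b c t → Sum x a c (s ∙ t)
  Sum-++ s (single b≤i i<c) = snoc (Sum-upper b≤i s) i<c
  Sum-++ {x} {a} {c = c} s (snoc {i = i} {s = t} t∈ i<c) =
    subst (Sum x a c) (assoc _ t (x i)) (snoc (Sum-++ s t∈) i<c)

  -- A sum subsystem in Baumgartner's sense. The half-open blocks are consecutive: `cut (suc i)`
  -- closes one block and opens the next.
  record _⊑_ (y x : ℕ → A) : Set where
    constructor mk⊑
    field
      cut   : ℕ → ℕ
      block : ∀ i → Sum x (cut i) (cut (suc i)) (y i)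

    cut-mono : ∀ {i j} → i ≤ j → cut i ≤ cut j
    cut-mono {i} {j} i≤j = go (≤⇒≤′ i≤j)
      where
      go : ∀ {j} → i ≤′ j → cut i ≤ cut j
      go ≤′-refl       = ≤-refl
      go (≤′-step i≤j) = ≤-trans (go i≤j) (<⇒≤ (Sum-nonempty (block _)))

    expand : ∀ {a b s} → Sum y a b s → Sum x (cut a) (cut b) s
    expand (single a≤i i<b) =
      Sum-lower (cut-mono a≤i) (Sum-upper (cut-mono i<b) (block _))
    expand (snoc s i<b)     =
      Sum-++ (expand s) (Sum-upper (cut-mono i<b) (block _))

  open _⊑_ public

  ⊑-refl : ∀ {x} → x ⊑ x
  ⊑-refl = mk⊑ id (λ i → single ≤-refl ≤-refl)

  ⊑-trans : ∀ {x y z} → z ⊑ y → y ⊑ x → z ⊑ x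
  ⊑-trans z⊑y y⊑x = mk⊑ (cut y⊑x ∘ cut z⊑y) (λ i → expand y⊑x (block z⊑y i))

  drop-⊑ : ∀ x b → (λ i → x (b + i)) ⊑ x
  drop-⊑ x b = mk⊑ (λ i → b + i) (λ i → single ≤-refl (+-monoʳ-< b ≤-refl))

  -- Baumgartner's largeness. The quantifier over all subsystems makes it pass to subsystems
  -- (`Large-⊑`), so that it survives the repeated refinements below.
  Large : (A → Set) → (ℕ → A) → Set
  Large X x = ∀ y → y ⊑ x → ∃[ s ] (FS y s × X s)

  Large-⊑ : ∀ {X x y} → y ⊑ x → Large X x → Large X y
  Large-⊑ y⊑x large z z⊑y = large z (⊑-trans z⊑y y⊑x)

  Large-map : ∀ {X Y : A → Set} {x} → (∀ {s} → X s → Y s) → Large X x → Large Y x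
  Large-map X⊆Y large z z⊑y = map₂ (map₂ X⊆Y) (large z z⊑y)

  Shift : (A → Set) → A → A → Set
  Shift X s t = X t × X (s ∙ t)

  -- What one step hands to the next: X ∩ (X - s) is large for a subsystem that starts only after
  -- the indices used by s. Because of `past`, the terms chosen in an iteration form successive
  -- blocks.
  record Continuation (X : A → Set) (x : ℕ → A) (s : A) : Set where
    field
      end   : ℕ
      sum∈  : Sum x 0 end s
      rest  : ℕ → A
      rest⊑ : rest ⊑ x
      past  : end ≤ cut rest⊑ 0
      large : Large (Shift X s) rest

  open Continuation public

  -- Q is what a step promises about its term besides the continuation: nothing for `shift`,
  -- membership in X for `shift-in`.
  module Iteration
    (Q : (A → Set) → A → Set)
    (step : ∀ {X x} → Large X x → ∃[ s ] (Q X s × Continuation X x s))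
    {X₀ : A → Set} {x₀ : ℕ → A} (large₀ : Large X₀ x₀)
    where

    record Stage : Set₁ where
      field
        X       : A → Set
        x       : ℕ → A
        embed   : x ⊑ x₀
        isLarge : Large X x

      term : A
      term = proj₁ (step isLarge)

      term-Q : Q X term
      term-Q = proj₁ (proj₂ (step isLarge))

      cont : Continuation X x term
      cont = proj₂ (proj₂ (step isLarge))

    open Stage public

    stage : ℕ → Stage
    stage zero    = record
      { X = X₀ ; x = x₀ ; embed = ⊑-refl ; isLarge = large₀ }
    stage (suc n) = record
      { X       = Shift (X (stage n)) (term (stage n))
      ; x       = rest (cont (stage n))
      ; embed   = ⊑-trans (rest⊑ (cont (stage n))) (embed (stage n))
      ; isLarge = large (cont (stage n))
      }

    terms : ℕ → A
    terms n = term (stage n)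

    terms⊑ : terms ⊑ x₀
    terms⊑ = mk⊑ (λ n → cut (embed (stage n)) 0) λ n →
      let e = embed (stage n) ; c = cont (stage n) in
      Sum-upper (cut-mono e (past c)) (expand e (sum∈ c))

    X-antitone : ∀ {m n t} → m ≤ n → X (stage n) t → X (stage m) t
    X-antitone m≤n = go (≤⇒≤′ m≤n)
      where
      go : ∀ {m n t} → m ≤′ n → X (stage n) t → X (stage m) t
      go ≤′-refl       = id
      go (≤′-step m≤n) = go m≤n ∘ proj₁

    -- The set of each stage lies in the translate of its predecessor by the term chosen there, so
    -- the terms of a sum can be put in front of t one by one, the last one first.
    X-shift : ∀ {a b s t} → Sum terms a b s →
              X (stage b) t → X (stage a) (s ∙ t)
    X-shift (single a≤i i<b) Xt =
      X-antitone a≤i (proj₂ (X-antitone i<b Xt))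
    X-shift {a} {t = t} (snoc {i = i} {s = s} s∈ i<b) Xt =
      subst (X (stage a)) (sym (assoc s (terms i) t))
        (X-shift s∈ (proj₂ (X-antitone i<b Xt)))

  module Classical (em : ExcludedMiddle 0ℓ) where

    -- If some subsystem has no sum in X ∩ Y b, pass to it and drop b from the list; otherwise X ∩ Y
    -- b is already large. The list cannot run out, because largeness provides a sum in X, which has
    -- to be covered.
    partition : ∀ {B : Set} (Y : B → A → Set) (L : List B) {X x} → Large X x →
      (∀ s → FS x s → X s → Any (λ b → Y b s) L) →
      ∃[ b ] (b ∈ L × ∃[ y ] (y ⊑ x × Large (λ s → X s × Y b s) y))
    partition Y [] large cover with _ , s∈ , Xs ← large _ ⊑-refl
      with () ← cover _ s∈ Xs
    partition Y (b ∷ L) {X} {x} large cover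
      with em {∃[ y ] (y ⊑ x × (∀ s → FS y s → X s → ¬ Y b s))}
    ... | no ¬avoid = b , here refl , x , ⊑-refl , largeᵇ
      where
      largeᵇ : Large (λ s → X s × Y b s) x
      largeᵇ y y⊑x with em {∃[ s ] (FS y s × X s × Y b s)}
      ... | yes p = p
      ... | no ¬p = contradiction
        (y , y⊑x , λ s s∈ Xs Ys → ¬p (s , s∈ , Xs , Ys)) ¬avoid
    ... | yes (y , y⊑x , avoid) =
      let b′ , b′∈L , z , z⊑y , l = partition Y L (Large-⊑ y⊑x large) cover′
      in b′ , there b′∈L , z , ⊑-trans z⊑y y⊑x , l
      where
      cover′ : ∀ s → FS y s → X s → Any (λ b → Y b s) L
      cover′ s s∈@(_ , _ , Σs) Xs
        with cover s (_ , _ , expand y⊑x Σs) Xs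
      ... | here Ys = contradiction Ys (avoid s s∈ Xs)
      ... | there p = p

    module _ {X : A → Set} {x : ℕ → A} (large₀ : Large X x) where

      private
        Bounded : List A → ℕ → Set
        Bounded L b = All (Sum x 0 b) L

        Covered : List A → A → Set
        Covered L t = Any (λ s → X (s ∙ t)) L

        Covering : Set
        Covering = ∃₂ λ L b → Bounded L b × (∀ c t → Sum x b c t → Covered L t)

      -- Without a covering, one builds blocks all of whose sums avoid X:
      -- a block is t ∙ u, where t avoids X − s for the sums s obtained so
      -- far, and u avoids X − t and X − (s ∙ t) for these s.
      private module _ (¬covering : ¬ Covering) where

        uncovered : ∀ {L b} → Bounded L b →
          ∃₂ λ c t → Sum x b c t × All (λ s → ¬ X (s ∙ t)) L
        uncovered {L} {b} bd
          with em {∃₂ λ c t → Sum x b c t × All (λ s → ¬ X (s ∙ t)) L}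
        ... | yes p = p
        ... | no ¬p = contradiction (L , b , bd , covered) ¬covering
          where
          covered : ∀ c t → Sum x b c t → Covered L t
          covered c t t∈ with em {Covered L t}
          ... | yes q = q
          ... | no ¬q = contradiction (c , t , t∈ , Allₚ.¬Any⇒All¬ L ¬q) ¬p

        record Avoiding : Set where
          field
            sums    : List A
            bound   : ℕ
            bounded : Bounded sums bound
            avoids  : All (¬_ ∘ X) sums

        open Avoiding

        augment : List A → A → List A
        augment L t = t ∷ map (_∙ t) L

        augment-bounded : ∀ {L b c t} → Bounded L b → Sum x b c t →
                          Bounded (augment L t) c
        augment-bounded bd t∈ =
          Sum-lower z≤n t∈ ∷ Allₚ.map⁺ (All.map (λ s∈ → Sum-++ s∈ t∈) bd)

        next : (S : Avoiding) →
          ∃[ e ] Σ[ S′ ∈ Avoiding ] (Sum x (bound S) (bound S′) e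
            × (∀ {s} → s ∈ sums S → s ∈ sums S′)
            × (∀ {s} → s ∈ augment (sums S) e → s ∈ sums S′))
        next S =
          let c , t , t∈ , _   = uncovered (bounded S)
              d , u , u∈ , ¬Xu = uncovered (augment-bounded (bounded S) t∈)
              e  = t ∙ u
              e∈ = Sum-++ t∈ u∈
          in e
           , record
               { sums    = sums S ++ augment (sums S) e
               ; bound   = d
               ; bounded = Allₚ.++⁺
                   (All.map (Sum-upper (<⇒≤ (Sum-nonempty e∈))) (bounded S))
                   (augment-bounded (bounded S) e∈)
               ; avoids  = Allₚ.++⁺ (avoids S)
                   (All.head ¬Xu ∷ Allₚ.map⁺ (All.map
                     (λ {s} ¬X → ¬X ∘ subst X (sym (assoc s t u)))
                     (Allₚ.map⁻ (All.tail ¬Xu))))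
               }
           , e∈ , ∈-++⁺ˡ , ∈-++⁺ʳ (sums S)

        avoiding : ℕ → Avoiding
        avoiding zero    =
          record { sums = [] ; bound = 0 ; bounded = [] ; avoids = [] }
        avoiding (suc n) = proj₁ (proj₂ (next (avoiding n)))

        blocks : ℕ → A
        blocks n = proj₁ (next (avoiding n))

        blocks⊑ : blocks ⊑ x
        blocks⊑ = mk⊑ (bound ∘ avoiding)
          (λ n → proj₁ (proj₂ (proj₂ (next (avoiding n)))))

        sums-mono : ∀ {m n s} → m ≤′ n →
                    s ∈ sums (avoiding m) → s ∈ sums (avoiding n)
        sums-mono ≤′-refl       = id
        sums-mono {n = suc n} (≤′-step m≤n) =
          proj₁ (proj₂ (proj₂ (proj₂ (next (avoiding n))))) ∘ sums-mono m≤n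

        sums-step : ∀ n {s} → s ∈ augment (sums (avoiding n)) (blocks n) →
                    s ∈ sums (avoiding (suc n))
        sums-step n = proj₂ (proj₂ (proj₂ (proj₂ (next (avoiding n)))))

        Sum⇒∈ : ∀ {a b s} → Sum blocks a b s → s ∈ sums (avoiding b)
        Sum⇒∈ (single {i = i} _ i<b) =
          sums-mono (≤⇒≤′ i<b) (sums-step i (here refl))
        Sum⇒∈ (snoc {i = i} s∈ i<b) =
          sums-mono (≤⇒≤′ i<b) (sums-step i (there (∈-map⁺ _ (Sum⇒∈ s∈))))

        ¬large : ¬ Large X x
        ¬large large with s , (a , b , s∈) , Xs ← large blocks blocks⊑ =
          All.lookup (avoids (avoiding b)) (Sum⇒∈ s∈) Xs

      abstract
        -- Given a covering, `partition` applies to the finitely many translates X - s and finds one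
        -- that is large together with X past the bound b. The sum s found here may lie outside X,
        -- which `shift-in` remedies.
        shift : ∃[ s ] Continuation X x s
        shift with em {Covering}
        ... | no ¬covering = ⊥-elim (¬large ¬covering large₀)
        ... | yes (L , b , bd , cover) =
          let s , s∈L , y , y⊑ , l = partition (λ s t → X (s ∙ t)) L
                (Large-⊑ (drop-⊑ x b) large₀)
                (λ t (a , c , t∈) _ → cover _ t
                  (Sum-lower (m≤m+n b a) (expand (drop-⊑ x b) t∈)))
          in s , record
            { end   = b
            ; sum∈  = All.lookup bd s∈L
            ; rest  = y
            ; rest⊑ = ⊑-trans y⊑ (drop-⊑ x b)
            ; past  = m≤m+n b _
            ; large = l
            }

    abstract
      -- Iterate shift; by largeness a sum of the shifts lies in X.
      shift-in : ∀ {X x} → Large X x → ∃[ s ] (X s × Continuation X x s)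
      shift-in large₀ =
        let s , (a , b , s∈) , Xs = large₀ I.terms I.terms⊑ in
        s , Xs , record
          { end   = cut I.terms⊑ b
          ; sum∈  = Sum-lower z≤n (expand I.terms⊑ s∈)
          ; rest  = I.x (I.stage b)
          ; rest⊑ = I.embed (I.stage b)
          -- The cuts of `terms⊑` are the starting points of the stages, so the bound for s is
          -- exactly where stage b starts.
          ; past  = ≤-refl
          ; large = Large-map
              (λ Xt → I.X-antitone {0} {b} z≤n Xt , I.X-shift (Sum-lower z≤n s∈) Xt)
              (I.isLarge (I.stage b))
          }
        where
        module I = Iteration (λ _ _ → ⊤) (λ l → map₂ (tt ,_) (shift l)) large₀

    -- The last term of a sum lies in the set of its own stage; putting the earlier terms in front
    -- of it with `X-shift` leads down to X.
    homogeneous : ∀ {X x} → Large X x →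
      ∃[ y ] (y ⊑ x × (∀ {s} → FS y s → X s))
    homogeneous {X} large₀ = I.terms , I.terms⊑ , λ (_ , _ , s∈) → in-X s∈
      where
      module I = Iteration (λ X s → X s) shift-in large₀

      in-stage : ∀ {a b s} → Sum I.terms a b s → I.X (I.stage a) s
      in-stage (single {i = i} a≤i _) = I.X-antitone a≤i (I.term-Q (I.stage i))
      in-stage (snoc {i = i} s∈ _)    = I.X-shift s∈ (I.term-Q (I.stage i))

      in-X : ∀ {a b s} → Sum I.terms a b s → X s
      in-X s∈ = in-stage (Sum-lower z≤n s∈)

    hindman : ∀ {k} (χ : A → Fin k) x →
      ∃[ c ] ∃[ y ] (y ⊑ x × (∀ {s} → FS y s → χ s ≡ c))
    hindman {k} χ x =
      let c , _ , y , y⊑x , l = partition (λ c s → χ s ≡ c) (allFin k)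
            {X = λ _ → ⊤} (λ y _ → y 0 , (0 , 1 , single z≤n ≤-refl) , tt)
            (λ s _ _ → lose (∈-allFin (χ s)) refl)
          z , z⊑y , mono = homogeneous l
      in c , z , ⊑-trans z⊑y y⊑x , λ s∈ → proj₂ (mono s∈)

-- Partition regularity of F

-- `fromℤ` divides by a gcd and so is stuck on a variable. In constructor form the arithmetic of ℚ
-- computes.
fromℤ-mkℚ : ∀ i → fromℤ i ≡ mkℚ i 0 (Coprime.sym (Coprime.1-coprimeTo ℤ.∣ i ∣))
fromℤ-mkℚ (+ n)    = ℚₚ.normalize-coprime (Coprime.sym (Coprime.1-coprimeTo n))
fromℤ-mkℚ -[1+ n ] =
  cong ℚ.-_ (ℚₚ.normalize-coprime (Coprime.sym (Coprime.1-coprimeTo (suc n))))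

fromℤ-+ : ∀ i j → fromℤ (i ℤ.+ j) ≡ fromℤ i ℚ.+ fromℤ j
fromℤ-+ i j rewrite fromℤ-mkℚ i | fromℤ-mkℚ j =
  cong fromℤ (sym (cong₂ ℤ._+_ (ℤₚ.*-identityʳ i) (ℤₚ.*-identityʳ j)))

fromℤ-* : ∀ i j → fromℤ (i ℤ.* j) ≡ fromℤ i ℚ.* fromℤ j
fromℤ-* i j rewrite fromℤ-mkℚ i | fromℤ-mkℚ j = refl

fromℤ-injective : ∀ {i j} → fromℤ i ≡ fromℤ j → i ≡ j
fromℤ-injective {i} {j} eq with *≡* i*1≡j*1 ← ℚₚ.fromℚᵘ-injective {mkℚᵘ i 0} {mkℚᵘ j 0} eq =
  ℤₚ.*-cancelʳ-≡ i j (+ 1) i*1≡j*1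

dot : ℕ → (ℕ → ℤ) → (ℕ → ℕ⁺) → ℤ
dot zero    a x = 0ℤ
dot (suc N) a x = a 0 ℤ.* + value (x 0) ℤ.+ dot N (a ∘ suc) (x ∘ suc)

integerRow-· : ∀ a N (a≡0 : ∀ i → N ≤ i → a i ≡ 0ℤ) x →
               integerRow {ω} a (N , a≡0) · x ≡ fromℤ (dot N a x)
integerRow-· a N _ x = go N a x
  where
  go : ∀ N a x → sum ℚ.+-0-rawMonoid {N}
         (λ i → fromℤ (a (toℕ i)) ℚ.* fromℕ⁺ (x (toℕ i))) ≡ fromℤ (dot N a x)
  go zero    a x = refl
  go (suc N) a x = sym (trans
    (fromℤ-+ (a 0 ℤ.* + value (x 0)) _)
    (cong₂ ℚ._+_ (fromℤ-* (a 0) (+ value (x 0))) (sym (go N (a ∘ suc) (x ∘ suc)))))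

value≢0 : (n : ℕ⁺) → value n ≢ 0
value≢0 (suc n ,ᵣ _) ()

_⊕_ : ℕ⁺ → ℕ⁺ → ℕ⁺
m@(suc _ ,ᵣ _) ⊕ n = (value m + value n) ,ᵣ [ _ ]

value-⊕ : ∀ m n → value (m ⊕ n) ≡ value m + value n
value-⊕ (suc _ ,ᵣ _) n = refl

⊕-assoc : Associative _≡_ _⊕_
⊕-assoc (suc k ,ᵣ _) m@(suc _ ,ᵣ _) n = value-injective (+-assoc (suc k) (value m) (value n))

open FiniteSums _⊕_ ⊕-assoc

dot-Sum : ∀ N c x → (∀ j → c j < 2) →
  ((∀ j → j < N → c j ≡ 0) × dot N (+_ ∘ c) x ≡ 0ℤ)
  ⊎ ∃[ s ] (Sum x 0 N s × dot N (+_ ∘ c) x ≡ + value s)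
dot-Sum zero    c x c<2 = inj₁ ((λ _ ()) , refl)
dot-Sum (suc N) c x c<2
  with c 0 in c₀ | c<2 0 | dot-Sum N (c ∘ suc) (x ∘ suc) (c<2 ∘ suc)
... | 0 | _ | inj₁ (c≡0 , dot≡0) =
  inj₁ ((λ { zero _ → c₀ ; (suc j) (s≤s j<N) → c≡0 j j<N })
       , trans (ℤₚ.+-identityˡ _) dot≡0)
... | 0 | _ | inj₂ (s , s∈ , dot≡s) =
  inj₂ (s , Sum-lower z≤n (expand (drop-⊑ x 1) s∈)
       , trans (ℤₚ.+-identityˡ _) dot≡s)
... | 1 | _ | inj₁ (_ , dot≡0) =
  inj₂ (x 0 , single z≤n z<s
       , trans (cong₂ ℤ._+_ (ℤₚ.*-identityˡ (+ value (x 0))) dot≡0) (ℤₚ.+-identityʳ _))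
... | 1 | _ | inj₂ (s , s∈ , dot≡s) =
  inj₂ (x 0 ⊕ s , Sum-++ (single z≤n z<s) (expand (drop-⊑ x 1) s∈)
       , trans (cong₂ ℤ._+_ (ℤₚ.*-identityˡ (+ value (x 0))) dot≡s)
               (cong +_ (sym (value-⊕ (x 0) s))))
... | suc (suc _) | s≤s (s≤s ()) | _

sum≡0 : ∀ N (c d : ℕ → ℕ) → (∀ j → j < N → c j ≡ 0) →
        sum +-0-rawMonoid {N} (λ j → c (toℕ j) * d (toℕ j)) ≡ 0
sum≡0 zero    c d c≡0 = refl
sum≡0 (suc N) c d c≡0 rewrite c≡0 0 z<s =
  sum≡0 N (c ∘ suc) (d ∘ suc) (λ j j<N → c≡0 (suc j) (s<s j<N))

F-· : ∀ i x → ∃[ s ] (Sum x 0 (suc i) s × F i · x ≡ fromℕ⁺ s)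
F-· i x with dot-Sum (suc i) (f i) x (f-binary i)
-- A row without a 1 would turn `f-sum` into 0 = i + 1.
... | inj₁ (f≡0 , _) =
  contradiction (trans (sym (f-sum i)) (sum≡0 (suc i) (f i) (2 ^_) f≡0)) λ ()
... | inj₂ (s , s∈ , dot≡s) =
  s , s∈ , trans (integerRow-· (+_ ∘ f i) (suc i)
    (λ j i<j → cong +_ (f-vanishes i j i<j)) x) (cong fromℤ dot≡s)

^-monoʳ-∣ : ∀ p {m n} → m ≤ n → p ^ m ∣ p ^ n
^-monoʳ-∣ p {m} m≤n = subst (λ k → p ^ m ∣ p ^ k) (m+[n∸m]≡n m≤n)
  (subst (p ^ m ∣_) (sym (^-distribˡ-+-* p m _)) (m∣m*n _))

-- The gap of 9 in the exponents is the 8 of `Rapid` and one more, which makes up for the size of a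
-- whole sum compared with its last term.
powers : ∀ p .{{_ : NonZero p}} → ℕ → ℕ⁺
powers p t = p ^ (9 * t) ,ᵣ [ m^n≢0 p (9 * t) ]

module _ {p} (1<p : 1 < p) where

  private instance
    p≢0 : NonZero p
    p≢0 = >-nonZero (<-trans z<s 1<p)

  ^-cancelʳ-< : ∀ {m n} → p ^ m < p ^ n → m < n
  ^-cancelʳ-< p^m<p^n = ≰⇒> (λ n≤m → <⇒≱ p^m<p^n (^-monoʳ-≤ p n≤m))

  Sum-powers-∣ : ∀ {a b s} → Sum (powers p) a b s → p ^ (9 * a) ∣ value s
  Sum-powers-∣ {a} (single {i = i} a≤i _) = ^-monoʳ-∣ p {9 * a} {9 * i} (*-monoʳ-≤ 9 a≤i)
  Sum-powers-∣ {a} (snoc {i = i} {s = s} s∈ _) =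
    subst (p ^ (9 * a) ∣_) (sym (value-⊕ s (powers p i)))
      (∣m∣n⇒∣m+n (Sum-powers-∣ s∈)
        (^-monoʳ-∣ p {9 * a} {9 * i} (*-monoʳ-≤ 9 (<⇒≤ (Sum-nonempty s∈)))))

  -- The eight powers of p to spare are those required by Rapid.
  Sum-powers-< : ∀ {a b s} → Sum (powers p) a b s →
                 p ^ 8 * value s < p ^ (9 * b)
  Sum-powers-< {b = b} (single {i = i} _ i<b) = begin-strict
    p ^ 8 * p ^ (9 * i)  ≡⟨ ^-distribˡ-+-* p 8 (9 * i) ⟨
    p ^ (8 + 9 * i)      <⟨ ^-monoʳ-< p 1<p (n<1+n (8 + 9 * i)) ⟩
    p ^ (9 + 9 * i)      ≡⟨ cong (p ^_) (*-suc 9 i) ⟨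
    p ^ (9 * suc i)      ≤⟨ ^-monoʳ-≤ p (*-monoʳ-≤ 9 i<b) ⟩
    p ^ (9 * b)          ∎
    where open ≤-Reasoning
  Sum-powers-< {b = b} (snoc {i = i} {s = s} s∈ i<b) = begin-strict
    p ^ 8 * value (s ⊕ powers p i)             ≡⟨ cong (p ^ 8 *_) (value-⊕ s (powers p i)) ⟩
    p ^ 8 * (value s + p ^ (9 * i))            ≡⟨ *-distribˡ-+ (p ^ 8) (value s) _ ⟩
    p ^ 8 * value s + p ^ 8 * p ^ (9 * i)      <⟨ +-monoˡ-< _ (Sum-powers-< s∈) ⟩
    p ^ (9 * i) + p ^ 8 * p ^ (9 * i)
      ≡⟨ cong (λ t → p ^ (9 * i) + t) (^-distribˡ-+-* p 8 (9 * i)) ⟨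
    p ^ (9 * i) + p ^ (8 + 9 * i)              ≤⟨ +-monoˡ-≤ _ (^-monoʳ-≤ p (m≤n+m (9 * i) 8)) ⟩
    p ^ (8 + 9 * i) + p ^ (8 + 9 * i)          ≡⟨ cong (λ t → p ^ (8 + 9 * i) + t) (+-identityʳ _) ⟨
    2 * p ^ (8 + 9 * i)                        ≤⟨ *-monoˡ-≤ _ 1<p ⟩
    p ^ (9 + 9 * i)                            ≡⟨ cong (p ^_) (*-suc 9 i) ⟨
    p ^ (9 * suc i)                            ≤⟨ ^-monoʳ-≤ p (*-monoʳ-≤ 9 i<b) ⟩
    p ^ (9 * b)                                ∎
    where open ≤-Reasoning

  -- At c = `cut x⊑ (suc i)`, block i is less than p^(9c - 8) while block i + 1 is divisible by
  -- p^(9c). So p^s ≤ x i forces s + 8 < 9c.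
  ⊑powers⇒Rapid : ∀ {x} → x ⊑ powers p → Rapid {ω} p x
  ⊑powers⇒Rapid {x} x⊑ i _ refl s p^s≤xᵢ =
    ∣-trans (^-monoʳ-∣ p {s + 8} {9 * cut x⊑ (suc i)}
      (<⇒≤ (^-cancelʳ-< {s + 8} {9 * cut x⊑ (suc i)} p^s+8<)))
      (Sum-powers-∣ (block x⊑ (suc i)))
    where
    open ≤-Reasoning
    p^s+8< : p ^ (s + 8) < p ^ (9 * cut x⊑ (suc i))
    p^s+8< = begin-strict
      p ^ (s + 8)                ≡⟨ cong (p ^_) (+-comm s 8) ⟩
      p ^ (8 + s)                ≡⟨ ^-distribˡ-+-* p 8 s ⟩
      p ^ 8 * p ^ s              ≤⟨ *-monoʳ-≤ (p ^ 8) p^s≤xᵢ ⟩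
      p ^ 8 * value (x i)        <⟨ Sum-powers-< (block x⊑ i) ⟩
      p ^ (9 * cut x⊑ (suc i))   ∎

F-rapid : ExcludedMiddle 0ℓ → RapidlyImagePartitionRegular {ω} {ω} F
F-rapid em k χ p pr =
  let instance _ = >-nonZero (<-trans z<s 1<p)
      c , x , x⊑ , mono = Classical.hindman em χ (powers p)
  in x , (c , λ i → let s , s∈ , eq = F-· i x in s , eq , mono (_ , _ , s∈))
       , ⊑powers⇒Rapid 1<p x⊑
  where
  1<p : 1 < p
  1<p = nonTrivial⇒n>1 p {{prime⇒nonTrivial pr}}

-- Rows of F

fromBinary : ℕ → (ℕ → ℕ) → ℕ
fromBinary zero    b = 0
fromBinary (suc N) b = b 0 + fromBinary N (b ∘ suc) * 2

binaryDigit-0 : ∀ j → binaryDigit 0 j ≡ 0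
binaryDigit-0 zero    = refl
binaryDigit-0 (suc j) = binaryDigit-0 j

binaryDigit-fromBinary : ∀ N b → (∀ j → b j < 2) → (∀ j → N ≤ j → b j ≡ 0) →
                         ∀ j → binaryDigit (fromBinary N b) j ≡ b j
binaryDigit-fromBinary zero    b b<2 b≡0 j = trans (binaryDigit-0 j) (sym (b≡0 j z≤n))
binaryDigit-fromBinary (suc N) b b<2 b≡0 zero =
  trans ([m+kn]%n≡m%n (b 0) (fromBinary N (b ∘ suc)) 2) (m<n⇒m%n≡m (b<2 0))
binaryDigit-fromBinary (suc N) b b<2 b≡0 (suc j) = begin
  binaryDigit ((b 0 + v * 2) / 2) j
    ≡⟨ cong (λ n → binaryDigit n j) (+-distrib-/-∣ʳ (b 0) (divides-refl v)) ⟩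
  binaryDigit (b 0 / 2 + v * 2 / 2) j
    ≡⟨ cong₂ (λ m n → binaryDigit (m + n) j) (m<n⇒m/n≡0 (b<2 0)) (m*n/n≡m v 2) ⟩
  binaryDigit v j
    ≡⟨ binaryDigit-fromBinary N (b ∘ suc) (b<2 ∘ suc) (λ j N≤j → b≡0 (suc j) (s≤s N≤j)) j ⟩
  b (suc j)                                   ∎
  where
  open ≡-Reasoning
  v = fromBinary N (b ∘ suc)

-- b lists the binary digits of `fromBinary N b`. Row i of F expands i + 1, so only the value zero
-- is left out.
zero-or-row : ∀ N b → (∀ j → b j < 2) → (∀ j → N ≤ j → b j ≡ 0) →
              (∀ j → b j ≡ 0) ⊎ ∃[ i ] (∀ j → f i j ≡ b j)
zero-or-row N b b<2 b≡0 with fromBinary N b | binaryDigit-fromBinary N b b<2 b≡0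
... | zero  | digits = inj₁ (λ j → trans (sym (digits j)) (binaryDigit-0 j))
... | suc i | digits = inj₂ (i , digits)

dot-cong : ∀ N {a b} x → (∀ j → a j ≡ b j) → dot N a x ≡ dot N b x
dot-cong zero    x a≗b = refl
dot-cong (suc N) x a≗b =
  cong₂ (λ n m → n ℤ.* + value (x 0) ℤ.+ m) (a≗b 0) (dot-cong N (x ∘ suc) (a≗b ∘ suc))

dot-0 : ∀ N x → dot N (λ _ → 0ℤ) x ≡ 0ℤ
dot-0 zero    x = refl
dot-0 (suc N) x = trans (ℤₚ.+-identityˡ _) (dot-0 N (x ∘ suc))

-- `dot` peels off the first term, whereas the digit arguments add terms of increasing size at the
-- end.
dot-suc : ∀ N a x → dot (suc N) a x ≡ dot N a x ℤ.+ a N ℤ.* + value (x N)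
dot-suc zero    a x = ℤₚ.+-comm (a 0 ℤ.* + value (x 0)) 0ℤ
dot-suc (suc N) a x = trans
  (cong (λ n → a 0 ℤ.* + value (x 0) ℤ.+ n) (dot-suc N (a ∘ suc) (x ∘ suc)))
  (sym (ℤₚ.+-assoc (a 0 ℤ.* + value (x 0)) (dot N (a ∘ suc) (x ∘ suc)) _))

unit : ℕ → ℕ → ℕ
unit zero    zero    = 1
unit zero    (suc j) = 0
unit (suc i) zero    = 0
unit (suc i) (suc j) = unit i j

unit<2 : ∀ i j → unit i j < 2
unit<2 zero    zero    = ≤-refl
unit<2 zero    (suc j) = z<s
unit<2 (suc i) zero    = z<s
unit<2 (suc i) (suc j) = unit<2 i j

unit≡0 : ∀ i j → i < j → unit i j ≡ 0
unit≡0 zero    (suc j) i<j       = refl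
unit≡0 (suc i) (suc j) (s≤s i<j) = unit≡0 i j i<j

unit≡1 : ∀ i → unit i i ≡ 1
unit≡1 zero    = refl
unit≡1 (suc i) = unit≡1 i

dot-unit : ∀ N j x → j < N → dot N (+_ ∘ unit j) x ≡ + value (x j)
dot-unit (suc N) zero    x _         = trans
  (cong₂ ℤ._+_ (ℤₚ.*-identityˡ (+ value (x 0))) (dot-0 N (x ∘ suc))) (ℤₚ.+-identityʳ _)
dot-unit (suc N) (suc j) x (s≤s j<N) =
  trans (ℤₚ.+-identityˡ _) (dot-unit N j (x ∘ suc) j<N)

F-·-dot : ∀ i x → F i · x ≡ fromℤ (dot (suc i) (+_ ∘ f i) x)
F-·-dot i = integerRow-· (+_ ∘ f i) (suc i) (λ j i<j → cong +_ (f-vanishes i j i<j))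

-- The unit vectors are rows of F, so every x j occurs in the image and receives the common colour.
F-single : ∀ j → ∃[ i ] (∀ x → F i · x ≡ fromℕ⁺ (x j))
F-single j with zero-or-row (suc j) (unit j) (unit<2 j) (unit≡0 j)
... | inj₁ unit≡0   = contradiction (trans (sym (unit≡1 j)) (unit≡0 j)) λ ()
... | inj₂ (i , f≗) = i , λ x → trans (F-·-dot i x) (cong fromℤ (trans
    (dot-cong (suc i) x (cong +_ ∘ f≗)) (dot-unit (suc i) j x j<1+i)))
  where
  -- Row i is summed only over its first i + 1 entries. Its 1 at position j must be among them,
  -- since `f i` vanishes further on.
  j<1+i : j < suc i
  j<1+i = ≰⇒> λ 1+i≤j → contradiction
    (trans (sym (unit≡1 j)) (trans (sym (f≗ j)) (f-vanishes i j 1+i≤j))) λ ()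

-- Row 2 expands 3 = 1 + 2. It is summed over three entries, whence the coefficient 0 of x 2.
F-pair : ∀ x → F 2 · x ≡ fromℤ (+ value (x 0) ℤ.+ + value (x 1))
F-pair x = trans (F-·-dot 2 x) (cong fromℤ (lemma (+ value (x 0)) (+ value (x 1)) (+ value (x 2))))
  where
  lemma : ∀ a b c → 1ℤ ℤ.* a ℤ.+ (1ℤ ℤ.* b ℤ.+ (0ℤ ℤ.* c ℤ.+ 0ℤ)) ≡ a ℤ.+ b
  lemma = solve-∀

-- Euclid's argument: a prime factor of n! + 1 cannot be at most n.
large-prime : ∀ n → ∃[ p ] (Prime p × n < p)
large-prime n with factorise (suc (n !))
... | record { factors = [] ; isFactorisation = eq } =
  contradiction (suc-injective eq) (n≢0 (n !) {{n !≢0}})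
  where
  n≢0 : ∀ m .{{_ : NonZero m}} → m ≢ 0
  n≢0 (suc m) ()
... | record { factors = p ∷ ps ; isFactorisation = eq ; factorsPrime = prime-p ∷ _ } =
  p , prime-p , ≰⇒> λ p≤n → ¬prime[1] (subst Prime (∣1⇒≡1 (p∣1 p≤n)) prime-p)
  where
  instance _ = prime⇒nonZero prime-p
  n∣n! : ∀ n .{{_ : NonZero n}} → n ∣ n !
  n∣n! (suc n) = m∣m*n (n !)
  p∣1 : p ≤ n → p ∣ 1
  p∣1 p≤n = ∣m+n∣m⇒∣n
    (subst (p ∣_) (trans (sym eq) (+-comm 1 (n !))) (m∣m*n (product ps)))
    (∣-trans (n∣n! p) (m≤n⇒m!∣n! p≤n))

prime-odd : ∀ {p} → Prime p → 2 < p → ∃[ h ] p ≡ suc (2 * h)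
prime-odd {p} prime-p 2<p with p % 2 in eq | m%n<n p 2
... | 1 | _ = p / 2 , trans (m≡m%n+[m/n]*n p 2) (cong₂ _+_ eq (*-comm (p / 2) 2))
... | suc (suc _) | s≤s (s≤s ())
... | 0 | _ with prime⇒irreducible prime-p (m%n≡0⇒n∣m p 2 eq)
...   | inj₂ 2≡p = contradiction 2≡p (<⇒≢ 2<p)

large-odd-prime : ∀ n → ∃₂ λ h p → p ≡ suc (2 * h) × Prime p × n < h
large-odd-prime n =
  -- The bound 2 (n + 1) < p makes p odd and turns into n < h after halving.
  let p , prime-p , n<p = large-prime (2 * suc n)
      h , p≡            = prime-odd prime-p
        (≤-<-trans (s≤s (s≤s z≤n)) (subst (_< p) (*-comm 2 (suc n)) n<p))
  in h , p , p≡ , prime-p , *-cancelˡ-≤ 2 (s≤s⁻¹ (subst (2 * suc n <_) p≡ n<p))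

bounded : ∀ N (r : ℕ → ℤ) → (∀ j → N ≤ j → r j ≡ 0ℤ) → ∃[ B ] (∀ j → ℤ.∣ r j ∣ ≤ B)
bounded zero    r r≡0 = 0 , λ j → ≤-reflexive (cong ℤ.∣_∣ (r≡0 j z≤n))
bounded (suc N) r r≡0 =
  let B , ≤B = bounded N (r ∘ suc) (λ j N≤j → r≡0 (suc j) (s≤s N≤j)) in
  ℤ.∣ r 0 ∣ + B , λ
    { zero    → m≤m+n _ B
    ; (suc j) → ≤-trans (≤B j) (m≤n+m B _)
    }

all-or-first-failure : ∀ {P : ℕ → Set} → (∀ j → P j ⊎ ¬ P j) → ∀ N →
  (∀ j → j < N → P j) ⊎ ∃[ j ] (j < N × ¬ P j × (∀ i → i < j → P i))
all-or-first-failure P? zero = inj₁ λ _ ()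
all-or-first-failure {P} P? (suc N) with all-or-first-failure P? N
... | inj₂ (j , j<N , rest) = inj₂ (j , m<n⇒m<1+n j<N , rest)
... | inj₁ all with P? N
...   | inj₂ ¬P = inj₂ (N , ≤-refl , ¬P , all)
...   | inj₁ PN = inj₁ λ j j<1+N → case (m≤n⇒m<n∨m≡n (s≤s⁻¹ j<1+N))
  where
  case : ∀ {j} → j < N ⊎ j ≡ N → P j
  case (inj₁ j<N)  = all _ j<N
  case (inj₂ refl) = PN

-- Balanced digits

module Balanced {h p : ℕ} (p≡ : p ≡ suc (2 * h)) (0<h : 0 < h) where

  private instance
    p≢0 : NonZero p
    p≢0 = subst NonZero (sym p≡) _

  P : ℤ
  P = + p

  Digit : Set
  Digit = Fin p

  -- Digits are stored with offset h, so they range over -h, ..., h and `𝟘` is the element h of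
  -- `Fin p`.
  ⟦_⟧ : Digit → ℤ
  ⟦ d ⟧ = + toℕ d ℤ.- + h

  𝟘 : Digit
  𝟘 = fromℕ< {h} (subst (h <_) (sym p≡) (s≤s (m≤m+n h _)))

  ⟦𝟘⟧ : ⟦ 𝟘 ⟧ ≡ 0ℤ
  ⟦𝟘⟧ = trans (cong (λ n → + n ℤ.- + h) (Finₚ.toℕ-fromℕ< _)) (ℤₚ.+-inverseʳ (+ h))

  -- p (w - v) is a difference of two numbers in [0, p), hence smaller than p in absolute value,
  -- hence 0.
  ⟦⟧-unique : ∀ {d e w v} → ⟦ d ⟧ ℤ.+ P ℤ.* w ≡ ⟦ e ⟧ ℤ.+ P ℤ.* v → d ≡ e × w ≡ v
  ⟦⟧-unique {d} {e} {w} {v} eq = Finₚ.toℕ-injective (ℤₚ.+-injective d≡e) , w≡v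
    where
    rearrange : ∀ a b c P w v → a ℤ.- c ℤ.+ P ℤ.* w ≡ b ℤ.- c ℤ.+ P ℤ.* v →
                P ℤ.* (w ℤ.- v) ≡ b ℤ.- a
    rearrange a b c P w v eq = begin
      P ℤ.* (w ℤ.- v)                                        ≡⟨ lemma₁ a c P w v ⟩
      (a ℤ.- c ℤ.+ P ℤ.* w) ℤ.- (a ℤ.- c ℤ.+ P ℤ.* v)  ≡⟨ cong (ℤ._- (a ℤ.- c ℤ.+ P ℤ.* v)) eq ⟩
      (b ℤ.- c ℤ.+ P ℤ.* v) ℤ.- (a ℤ.- c ℤ.+ P ℤ.* v)  ≡⟨ lemma₂ a b c P v ⟩
      b ℤ.- a                                                ∎
      where
      open ≡-Reasoning
      lemma₁ : ∀ a c P w v → P ℤ.* (w ℤ.- v) ≡ (a ℤ.- c ℤ.+ P ℤ.* w) ℤ.- (a ℤ.- c ℤ.+ P ℤ.* v)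
      lemma₁ = solve-∀
      lemma₂ : ∀ a b c P v → (b ℤ.- c ℤ.+ P ℤ.* v) ℤ.- (a ℤ.- c ℤ.+ P ℤ.* v) ≡ b ℤ.- a
      lemma₂ = solve-∀

    P[w-v]≡e-d : P ℤ.* (w ℤ.- v) ≡ + toℕ e ℤ.- + toℕ d
    P[w-v]≡e-d = rearrange (+ toℕ d) (+ toℕ e) (+ h) P w v eq

    p∣w-v∣<p : p * ℤ.∣ w ℤ.- v ∣ < p * 1
    p∣w-v∣<p = begin-strict
      p * ℤ.∣ w ℤ.- v ∣              ≡⟨ ℤₚ.abs-* P (w ℤ.- v) ⟨
      ℤ.∣ P ℤ.* (w ℤ.- v) ∣          ≡⟨ cong ℤ.∣_∣ P[w-v]≡e-d ⟩
      ℤ.∣ + toℕ e ℤ.- + toℕ d ∣      ≡⟨ cong ℤ.∣_∣ (ℤₚ.m-n≡m⊖n (toℕ e) (toℕ d)) ⟩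
      ℤ.∣ toℕ e ℤ.⊖ toℕ d ∣          ≤⟨ ℤₚ.∣m⊝n∣≤m⊔n (toℕ e) (toℕ d) ⟩
      toℕ e ⊔ toℕ d                  <⟨ ⊔-lub (Finₚ.toℕ<n e) (Finₚ.toℕ<n d) ⟩
      p                              ≡⟨ *-identityʳ p ⟨
      p * 1                          ∎
      where open ≤-Reasoning

    w-v≡0 : w ℤ.- v ≡ 0ℤ
    w-v≡0 = ℤₚ.∣i∣≡0⇒i≡0 (n<1⇒n≡0 (*-cancelˡ-< p _ _ p∣w-v∣<p))

    w≡v : w ≡ v
    w≡v = ℤₚ.i-j≡0⇒i≡j w v w-v≡0

    d≡e : + toℕ d ≡ + toℕ e
    d≡e = sym (ℤₚ.i-j≡0⇒i≡j (+ toℕ e) (+ toℕ d) (trans (sym P[w-v]≡e-d)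
      (trans (cong (P ℤ.*_) w-v≡0) (ℤₚ.*-zeroʳ P))))

  abstract
    -- Adding h before the division centres the residues. Outside this block only `δ-quot` is known
    -- of `δ` and `quot`; by `⟦⟧-unique` it determines them.
    δ : ℤ → Digit
    δ z = fromℕ< (n%ℕd<d (z ℤ.+ + h) p)

    quot : ℤ → ℤ
    quot z = (z ℤ.+ + h) /ℕ p

    δ-quot : ∀ z → z ≡ ⟦ δ z ⟧ ℤ.+ P ℤ.* quot z
    δ-quot z = begin
      z                                                  ≡⟨ lemma₁ z (+ h) ⟩
      z ℤ.+ + h ℤ.- + h
        ≡⟨ cong (ℤ._- + h) (a≡a%ℕn+[a/ℕn]*n (z ℤ.+ + h) p) ⟩
      + ((z ℤ.+ + h) %ℕ p) ℤ.+ quot z ℤ.* P ℤ.- + h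
        ≡⟨ cong (λ n → + n ℤ.+ quot z ℤ.* P ℤ.- + h) (Finₚ.toℕ-fromℕ< (n%ℕd<d (z ℤ.+ + h) p)) ⟨
      + toℕ (δ z) ℤ.+ quot z ℤ.* P ℤ.- + h               ≡⟨ lemma₂ (+ toℕ (δ z)) (quot z) P (+ h) ⟩
      ⟦ δ z ⟧ ℤ.+ P ℤ.* quot z                           ∎
      where
      open ≡-Reasoning
      lemma₁ : ∀ z h → z ≡ z ℤ.+ h ℤ.- h
      lemma₁ = solve-∀
      lemma₂ : ∀ d q P h → d ℤ.+ q ℤ.* P ℤ.- h ≡ d ℤ.- h ℤ.+ P ℤ.* q
      lemma₂ = solve-∀

  δ-quot-+ : ∀ u w → δ (u ℤ.+ P ℤ.* w) ≡ δ u × quot (u ℤ.+ P ℤ.* w) ≡ quot u ℤ.+ w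
  δ-quot-+ u w = ⟦⟧-unique (begin
    ⟦ δ z ⟧ ℤ.+ P ℤ.* quot z                ≡⟨ δ-quot z ⟨
    u ℤ.+ P ℤ.* w                           ≡⟨ cong (ℤ._+ P ℤ.* w) (δ-quot u) ⟩
    ⟦ δ u ⟧ ℤ.+ P ℤ.* quot u ℤ.+ P ℤ.* w    ≡⟨ lemma ⟦ δ u ⟧ P (quot u) w ⟩
    ⟦ δ u ⟧ ℤ.+ P ℤ.* (quot u ℤ.+ w)        ∎)
    where
    open ≡-Reasoning
    z = u ℤ.+ P ℤ.* w
    lemma : ∀ d P q w → d ℤ.+ P ℤ.* q ℤ.+ P ℤ.* w ≡ d ℤ.+ P ℤ.* (q ℤ.+ w)
    lemma = solve-∀

  ∣⟦_⟧∣≤h : ∀ d → ℤ.∣ ⟦ d ⟧ ∣ ≤ h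
  ∣⟦ d ⟧∣≤h rewrite ℤₚ.m-n≡m⊖n (toℕ d) h with ≤-total (toℕ d) h
  ... | inj₁ d≤h rewrite ℤₚ.∣⊖∣-≤ d≤h = m∸n≤m h (toℕ d)
  ... | inj₂ h≤d rewrite ℤₚ.∣m⊖n∣≡∣n⊖m∣ (toℕ d) h | ℤₚ.∣⊖∣-≤ h≤d =
    m≤n+o⇒m∸n≤o (toℕ d) h (subst (toℕ d ≤_) (cong (λ n → h + n) (+-identityʳ h))
      (s≤s⁻¹ (subst (toℕ d <_) p≡ (Finₚ.toℕ<n d))))

  -- (pᴸ − 1) / 2
  half : ℕ → ℕ
  half zero    = 0
  half (suc L) = h + p * half L

  suc-2half : ∀ L → suc (2 * half L) ≡ p ^ L
  suc-2half zero    = refl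
  suc-2half (suc L) = trans lemma (cong (p *_) (suc-2half L))
    where
    open +-*-Solver
    identity : ∀ h a → suc (2 * (h + suc (2 * h) * a)) ≡ suc (2 * h) * suc (2 * a)
    identity = solve 2 (λ h a →
      con 1 :+ con 2 :* (h :+ (con 1 :+ con 2 :* h) :* a)
      := (con 1 :+ con 2 :* h) :* (con 1 :+ con 2 :* a)) refl

    lemma : suc (2 * (h + p * half L)) ≡ p * suc (2 * half L)
    lemma = subst (λ p → suc (2 * (h + p * half L)) ≡ p * suc (2 * half L))
                  (sym p≡) (identity h (half L))

  half-mono : ∀ {L M} → L ≤ M → half L ≤ half M
  half-mono {zero}  _         = z≤n
  half-mono {suc L} (s≤s L≤M) = +-monoʳ-≤ h (*-monoʳ-≤ p (half-mono L≤M))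

  n≤half : ∀ n → n ≤ half n
  n≤half zero    = z≤n
  n≤half (suc n) = +-mono-≤ 0<h (≤-trans (n≤half n) (m≤n*m (half n) p))

  -- These are the integers with at most L balanced digits.
  Fits : ℕ → ℤ → Set
  Fits L z = ℤ.∣ z ∣ ≤ half L

  -- A crude length, but one that needs no logarithm; it serves as fuel in `Lowest`, `Top` and
  -- `Count`.
  fits-self : ∀ z → Fits ℤ.∣ z ∣ z
  fits-self z = n≤half ℤ.∣ z ∣

  fits-quot : ∀ L z → Fits (suc L) z → Fits L (quot z)
  fits-quot L z fits = s≤s⁻¹ (*-cancelˡ-< p _ _ (begin-strict
    p * ℤ.∣ quot z ∣                ≡⟨ ℤₚ.abs-* P (quot z) ⟨
    ℤ.∣ P ℤ.* quot z ∣              ≡⟨ cong ℤ.∣_∣ pq≡ ⟩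
    ℤ.∣ z ℤ.- ⟦ δ z ⟧ ∣             ≤⟨ ℤₚ.∣i-j∣≤∣i∣+∣j∣ z ⟦ δ z ⟧ ⟩
    ℤ.∣ z ∣ + ℤ.∣ ⟦ δ z ⟧ ∣         ≤⟨ +-mono-≤ fits ∣⟦ δ z ⟧∣≤h ⟩
    h + p * half L + h              ≡⟨ +-comm _ h ⟩
    h + (h + p * half L)            ≡⟨ +-assoc h h _ ⟨
    h + h + p * half L              ≡⟨ cong (λ n → h + n + p * half L) (+-identityʳ h) ⟨
    2 * h + p * half L              <⟨ +-monoˡ-< (p * half L) (≤-reflexive (sym p≡)) ⟩
    p + p * half L                  ≡⟨ *-suc p (half L) ⟨
    p * suc (half L)                ∎))
    where
    open ≤-Reasoning
    lemma : ∀ d q → q ≡ d ℤ.+ q ℤ.- d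
    lemma = solve-∀
    pq≡ : P ℤ.* quot z ≡ z ℤ.- ⟦ δ z ⟧
    pq≡ = trans (lemma ⟦ δ z ⟧ (P ℤ.* quot z)) (cong (ℤ._- ⟦ δ z ⟧) (sym (δ-quot z)))

  fits-zero : ∀ z → Fits 0 z → z ≡ 0ℤ
  fits-zero z fits = ℤₚ.∣i∣≡0⇒i≡0 (n≤0⇒n≡0 fits)

  δ-0 : δ 0ℤ ≡ 𝟘 × quot 0ℤ ≡ 0ℤ
  δ-0 = ⟦⟧-unique (trans (sym (δ-quot 0ℤ)) (sym (cong₂ ℤ._+_ ⟦𝟘⟧ (ℤₚ.*-zeroʳ P))))

  -- Reading digits: the lowest and the two highest

  State : Set
  State = (Digit × Digit) × Digit

  -- The first component of a state is the last nonzero digit read together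
  -- with its predecessor, the second component is the last digit read.
  step : Digit → State → State
  step d (t , e) with d Finₚ.≟ 𝟘
  ... | yes _ = t , 𝟘
  ... | no  _ = (d , e) , d

  -- Digits are read from the lowest upwards, so the pair that remains consists of the highest
  -- nonzero digit and the digit below it.
  scan : ℕ → ℤ → State → State
  scan zero    z s = s
  scan (suc L) z s = scan L (quot z) (step (δ z) s)

  infixr 5 _orElse_
  _orElse_ : Digit → Digit → Digit
  d orElse e with d Finₚ.≟ 𝟘
  ... | yes _ = e
  ... | no  _ = d

  lowest : ℕ → ℤ → Digit
  lowest zero    z = 𝟘
  lowest (suc L) z = δ z orElse lowest L (quot z)

  𝟘-orElse : ∀ d → 𝟘 orElse d ≡ d
  𝟘-orElse d with 𝟘 Finₚ.≟ 𝟘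
  ... | yes _ = refl
  ... | no 𝟘≢𝟘 = contradiction refl 𝟘≢𝟘

  ≢𝟘-orElse : ∀ {d} e → d ≢ 𝟘 → d orElse e ≡ d
  ≢𝟘-orElse {d} e d≢𝟘 with d Finₚ.≟ 𝟘
  ... | yes d≡𝟘 = contradiction d≡𝟘 d≢𝟘
  ... | no _    = refl

  orElse-assoc : ∀ a b c → (a orElse b) orElse c ≡ a orElse (b orElse c)
  orElse-assoc a b c with a Finₚ.≟ 𝟘
  ... | yes _   = refl
  ... | no a≢𝟘 = ≢𝟘-orElse c a≢𝟘

  step-𝟘 : ∀ t e → step 𝟘 (t , e) ≡ (t , 𝟘)
  step-𝟘 t e with 𝟘 Finₚ.≟ 𝟘
  ... | yes _ = refl
  ... | no 𝟘≢𝟘 = contradiction refl 𝟘≢𝟘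

  module _ (k : ℕ) (y : ℤ) where

    private
      shifted : ∀ u → u ℤ.+ + (p ^ suc k) ℤ.* y ≡ u ℤ.+ P ℤ.* (+ (p ^ k) ℤ.* y)
      shifted u = cong (λ n → u ℤ.+ n) (trans (cong (ℤ._* y) (ℤₚ.pos-* p (p ^ k)))
        (ℤₚ.*-assoc P (+ (p ^ k)) y))

    δ-shift : ∀ u → δ (u ℤ.+ + (p ^ suc k) ℤ.* y) ≡ δ u
    δ-shift u = trans (cong δ (shifted u)) (proj₁ (δ-quot-+ u _))

    quot-shift : ∀ u → quot (u ℤ.+ + (p ^ suc k) ℤ.* y) ≡ quot u ℤ.+ + (p ^ k) ℤ.* y
    quot-shift u = trans (cong quot (shifted u)) (proj₂ (δ-quot-+ u _))

  fits-0-+ : ∀ u y → Fits 0 u → u ℤ.+ + (p ^ 0) ℤ.* y ≡ y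
  fits-0-+ u y fits = trans (cong₂ ℤ._+_ (fits-zero u fits) (ℤₚ.*-identityˡ y)) (ℤₚ.+-identityˡ y)

  -- No carry occurs: u occupies at most the lowest k positions, so the digits of the sum are those
  -- of u, filled up with zeros to length k, followed by those of y.
  scan-++ : ∀ k m u y s → Fits k u →
            scan (k + m) (u ℤ.+ + (p ^ k) ℤ.* y) s ≡ scan m y (scan k u s)
  scan-++ zero    m u y s fits = cong (λ z → scan m z s) (fits-0-+ u y fits)
  scan-++ (suc k) m u y s fits =
    trans (cong₂ (λ q d → scan (k + m) q (step d s)) (quot-shift k y u) (δ-shift k y u))
          (scan-++ k m (quot u) y (step (δ u) s) (fits-quot k u fits))

  lowest-++ : ∀ k m u y → Fits k u →
              lowest (k + m) (u ℤ.+ + (p ^ k) ℤ.* y) ≡ lowest k u orElse lowest m y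
  lowest-++ zero    m u y fits =
    trans (cong (lowest m) (fits-0-+ u y fits)) (sym (𝟘-orElse _))
  lowest-++ (suc k) m u y fits =
    trans (cong₂ (λ q d → d orElse lowest (k + m) q) (quot-shift k y u) (δ-shift k y u))
    (trans (cong (δ u orElse_) (lowest-++ k m (quot u) y (fits-quot k u fits)))
           (sym (orElse-assoc (δ u) _ _)))

  scan-0 : ∀ m t → scan m 0ℤ (t , 𝟘) ≡ (t , 𝟘)
  scan-0 zero    t = refl
  scan-0 (suc m) t = begin
    scan m (quot 0ℤ) (step (δ 0ℤ) (t , 𝟘))
      ≡⟨ cong₂ (λ d q → scan m q (step d (t , 𝟘))) (proj₁ δ-0) (proj₂ δ-0) ⟩
    scan m 0ℤ (step 𝟘 (t , 𝟘))              ≡⟨ cong (scan m 0ℤ) (step-𝟘 t 𝟘) ⟩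
    scan m 0ℤ (t , 𝟘)                       ≡⟨ scan-0 m t ⟩
    (t , 𝟘)                                 ∎
    where open ≡-Reasoning

  lowest-0 : ∀ m → lowest m 0ℤ ≡ 𝟘
  lowest-0 zero    = refl
  lowest-0 (suc m) = trans (cong₂ (λ d q → d orElse lowest m q) (proj₁ δ-0) (proj₂ δ-0))
    (trans (𝟘-orElse (lowest m 0ℤ)) (lowest-0 m))

  lowest-≢𝟘 : ∀ L z → Fits L z → z ≢ 0ℤ → lowest L z ≢ 𝟘
  lowest-≢𝟘 zero    z fits z≢0 = contradiction (fits-zero z fits) z≢0
  lowest-≢𝟘 (suc L) z fits z≢0 with δ z Finₚ.≟ 𝟘
  ... | no δ≢𝟘  = δ≢𝟘
  ... | yes δ≡𝟘 = lowest-≢𝟘 L (quot z) (fits-quot L z fits) λ q≡0 → z≢0 (begin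
    z                              ≡⟨ δ-quot z ⟩
    ⟦ δ z ⟧ ℤ.+ P ℤ.* quot z       ≡⟨ cong₂ (λ d q → ⟦ d ⟧ ℤ.+ P ℤ.* q) δ≡𝟘 q≡0 ⟩
    ⟦ 𝟘 ⟧ ℤ.+ P ℤ.* 0ℤ             ≡⟨ cong₂ ℤ._+_ ⟦𝟘⟧ (ℤₚ.*-zeroʳ P) ⟩
    0ℤ                             ∎)
    where open ≡-Reasoning

  -- From a state with previous digit 𝟘, what is read first does not interact
  -- with what was read before.
  scan-sync : ∀ L z t t′ → lowest L z ≢ 𝟘 → scan L z (t , 𝟘) ≡ scan L z (t′ , 𝟘)
  scan-sync zero    z t t′ low≢𝟘 = contradiction refl low≢𝟘
  scan-sync (suc L) z t t′ low≢𝟘 with δ z Finₚ.≟ 𝟘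
  ... | yes _ = scan-sync L (quot z) t t′ low≢𝟘
  ... | no _  = refl

  fits-mono : ∀ {L M} z → L ≤ M → Fits L z → Fits M z
  fits-mono z L≤M fits = ≤-trans fits (half-mono L≤M)

  +p^*0 : ∀ k z → z ℤ.+ + (p ^ k) ℤ.* 0ℤ ≡ z
  +p^*0 k z = trans (cong (λ n → z ℤ.+ n) (ℤₚ.*-zeroʳ (+ (p ^ k)))) (ℤₚ.+-identityʳ z)

  scan-pad : ∀ k m z s → Fits k z → scan (k + m) z s ≡ scan m 0ℤ (scan k z s)
  scan-pad k m z s fits =
    trans (cong (λ z → scan (k + m) z s) (sym (+p^*0 k z))) (scan-++ k m z 0ℤ s fits)

  lowest-pad : ∀ k m z → Fits k z → lowest (k + m) z ≡ lowest k z
  lowest-pad k m z fits = begin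
    lowest (k + m) z                             ≡⟨ cong (lowest (k + m)) (+p^*0 k z) ⟨
    lowest (k + m) (z ℤ.+ + (p ^ k) ℤ.* 0ℤ)      ≡⟨ lowest-++ k m z 0ℤ fits ⟩
    lowest k z orElse lowest m 0ℤ                ≡⟨ cong (lowest k z orElse_) (lowest-0 m) ⟩
    lowest k z orElse 𝟘                          ≡⟨ orElse-𝟘 (lowest k z) ⟩
    lowest k z                                   ∎
    where
    open ≡-Reasoning
    orElse-𝟘 : ∀ d → d orElse 𝟘 ≡ d
    orElse-𝟘 d with d Finₚ.≟ 𝟘
    ... | yes d≡𝟘 = sym d≡𝟘
    ... | no _    = refl

  start : State
  start = (𝟘 , 𝟘) , 𝟘

  Lowest : ℤ → Digit
  Lowest z = lowest ℤ.∣ z ∣ z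

  Top : ℤ → Digit × Digit
  Top z = proj₁ (scan ℤ.∣ z ∣ z start)

  scan-pad-top : ∀ k m z s → Fits k z → proj₁ (scan (k + m) z s) ≡ proj₁ (scan k z s)
  scan-pad-top k m z s fits = trans (cong proj₁ (scan-pad k m z s fits)) (top-0 m (scan k z s))
    where
    top-0 : ∀ m s → proj₁ (scan m 0ℤ s) ≡ proj₁ s
    top-0 zero    s       = refl
    top-0 (suc m) (t , e) = begin
      proj₁ (scan m (quot 0ℤ) (step (δ 0ℤ) (t , e)))
        ≡⟨ cong₂ (λ d q → proj₁ (scan m q (step d (t , e)))) (proj₁ δ-0) (proj₂ δ-0) ⟩
      proj₁ (scan m 0ℤ (step 𝟘 (t , e)))              ≡⟨ top-0 m (step 𝟘 (t , e)) ⟩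
      proj₁ (step 𝟘 (t , e))                          ≡⟨ cong proj₁ (step-𝟘 t e) ⟩
      t                                               ∎
      where open ≡-Reasoning

  -- Both lengths suffice for z, so both can be padded to their sum. `Top-fits` and `Count-fits`
  -- follow the same pattern.
  Lowest-fits : ∀ L z → Fits L z → Lowest z ≡ lowest L z
  Lowest-fits L z fits = begin
    lowest ℤ.∣ z ∣ z          ≡⟨ lowest-pad ℤ.∣ z ∣ L z (fits-self z) ⟨
    lowest (ℤ.∣ z ∣ + L) z    ≡⟨ cong (λ n → lowest n z) (+-comm ℤ.∣ z ∣ L) ⟩
    lowest (L + ℤ.∣ z ∣) z    ≡⟨ lowest-pad L ℤ.∣ z ∣ z fits ⟩
    lowest L z                ∎
    where open ≡-Reasoning

  Top-fits : ∀ L z → Fits L z → Top z ≡ proj₁ (scan L z start)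
  Top-fits L z fits = begin
    Top z                                     ≡⟨ scan-pad-top ℤ.∣ z ∣ L z start (fits-self z) ⟨
    proj₁ (scan (ℤ.∣ z ∣ + L) z start)
      ≡⟨ cong (λ n → proj₁ (scan n z start)) (+-comm ℤ.∣ z ∣ L) ⟩
    proj₁ (scan (L + ℤ.∣ z ∣) z start)        ≡⟨ scan-pad-top L ℤ.∣ z ∣ z start fits ⟩
    proj₁ (scan L z start)                    ∎
    where open ≡-Reasoning

  Lowest-≢𝟘 : ∀ {z} → z ≢ 0ℤ → Lowest z ≢ 𝟘
  Lowest-≢𝟘 {z} = lowest-≢𝟘 ℤ.∣ z ∣ z (fits-self z)

  -- Counting occurrences of a digit pattern

  _≟ₜ_ = ≡-dec (Finₚ._≟_ {p}) (Finₚ._≟_ {p})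

  -- Counts the nonzero digits v* such that T* consists of the preceding nonzero
  -- digit and its predecessor.
  module Counting (T* : Digit × Digit) (v* : Digit) where

    hit : Digit × Digit → Digit → ℕ
    hit t d = if does (t ≟ₜ T*) ∧ does (d Finₚ.≟ v*) then 1 else 0

    hit-yes : ∀ {t d} → t ≡ T* → d ≡ v* → hit t d ≡ 1
    hit-yes {t} {d} t≡ d≡ rewrite dec-true (t ≟ₜ T*) t≡ | dec-true (d Finₚ.≟ v*) d≡ = refl

    hit-≢ˡ : ∀ {t} d → t ≢ T* → hit t d ≡ 0
    hit-≢ˡ {t} d t≢ rewrite dec-false (t ≟ₜ T*) t≢ = refl

    hit-≢ʳ : ∀ t {d} → d ≢ v* → hit t d ≡ 0
    hit-≢ʳ t {d} d≢ with does (t ≟ₜ T*)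
    ... | false = refl
    ... | true rewrite dec-false (d Finₚ.≟ v*) d≢ = refl

    hit≤1 : ∀ t d → hit t d ≤ 1
    hit≤1 t d with does (t ≟ₜ T*) ∧ does (d Finₚ.≟ v*)
    ... | true  = ≤-refl
    ... | false = z≤n

    count : ℕ → ℤ → State → ℕ
    count zero    z s = 0
    count (suc L) z s = hit (proj₁ s) (δ z) + count L (quot z) (step (δ z) s)

    count-++ : ∀ k m u y s → Fits k u →
      count (k + m) (u ℤ.+ + (p ^ k) ℤ.* y) s ≡ count k u s + count m y (scan k u s)
    count-++ zero    m u y s fits = cong (λ z → count m z s) (fits-0-+ u y fits)
    count-++ (suc k) m u y s fits =
      trans (cong₂ (λ q d → hit (proj₁ s) d + count (k + m) q (step d s))
                   (quot-shift k y u) (δ-shift k y u))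
      (trans (cong (λ n → hit (proj₁ s) (δ u) + n)
                   (count-++ k m (quot u) y (step (δ u) s) (fits-quot k u fits)))
             (sym (+-assoc (hit (proj₁ s) (δ u)) _ _)))

    Count : ℤ → ℕ
    Count z = count ℤ.∣ z ∣ z start

    -- (𝟘 , 𝟘) is the pair in `start`, before any nonzero digit has been read. Excluding it, and
    -- zero as the digit awaited, means that neither the start nor padding zeros are counted.
    module Properties (T*≢𝟘 : T* ≢ (𝟘 , 𝟘)) (v*≢𝟘 : v* ≢ 𝟘) where

      count-0 : ∀ m s → count m 0ℤ s ≡ 0
      count-0 zero    s = refl
      count-0 (suc m) s =
        trans (cong₂ (λ d q → hit (proj₁ s) d + count m q (step d s)) (proj₁ δ-0) (proj₂ δ-0))
              (cong₂ _+_ (hit-≢ʳ (proj₁ s) (v*≢𝟘 ∘ sym)) (count-0 m (step 𝟘 s)))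

      count-pad : ∀ k m z s → Fits k z → count (k + m) z s ≡ count k z s
      count-pad k m z s fits = begin
        count (k + m) z s
          ≡⟨ cong (λ z → count (k + m) z s) (+p^*0 k z) ⟨
        count (k + m) (z ℤ.+ + (p ^ k) ℤ.* 0ℤ) s       ≡⟨ count-++ k m z 0ℤ s fits ⟩
        count k z s + count m 0ℤ (scan k z s)
          ≡⟨ cong (λ n → count k z s + n) (count-0 m (scan k z s)) ⟩
        count k z s + 0                                ≡⟨ +-identityʳ _ ⟩
        count k z s                                    ∎
        where open ≡-Reasoning

      -- The inherited pair t is compared with the first nonzero digit only. That digit replaces t,
      -- and since the digit before it is 𝟘, the scan continues as from `start`.
      count-sync : ∀ L z t →
        count L z (t , 𝟘) ≡ hit t (lowest L z) + count L z start
      count-sync zero    z t = sym (trans (+-identityʳ _) (hit-≢ʳ t (v*≢𝟘 ∘ sym)))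
      count-sync (suc L) z t with δ z Finₚ.≟ 𝟘
      ... | no _    = cong (λ n → hit t (δ z) + n) (sym
        (cong (_+ count L (quot z) ((δ z , 𝟘) , δ z)) (hit-≢ˡ (δ z) (T*≢𝟘 ∘ sym))))
      ... | yes δ≡𝟘 = begin
        hit t (δ z) + count L (quot z) (t , 𝟘)
          ≡⟨ cong (_+ count L (quot z) (t , 𝟘)) (hit-δ t) ⟩
        count L (quot z) (t , 𝟘)                                ≡⟨ count-sync L (quot z) t ⟩
        hit t (lowest L (quot z)) + count L (quot z) start
          ≡⟨ cong (λ n → hit t (lowest L (quot z)) + (n + count L (quot z) start)) (hit-δ (𝟘 , 𝟘)) ⟨
        hit t (lowest L (quot z)) + (hit (𝟘 , 𝟘) (δ z) + count L (quot z) start)  ∎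
        where
        open ≡-Reasoning
        hit-δ : ∀ t → hit t (δ z) ≡ 0
        hit-δ t = hit-≢ʳ t (λ δ≡v* → v*≢𝟘 (trans (sym δ≡v*) δ≡𝟘))

      Count-fits : ∀ L z → Fits L z → Count z ≡ count L z start
      Count-fits L z fits = begin
        count ℤ.∣ z ∣ z start          ≡⟨ count-pad ℤ.∣ z ∣ L z start (fits-self z) ⟨
        count (ℤ.∣ z ∣ + L) z start    ≡⟨ cong (λ n → count n z start) (+-comm ℤ.∣ z ∣ L) ⟩
        count (L + ℤ.∣ z ∣) z start    ≡⟨ count-pad L ℤ.∣ z ∣ z start fits ⟩
        count L z start                ∎
        where open ≡-Reasoning

  -- The digits of u end before those of y begin; the exponent k + 1 leaves a zero
  -- digit in between, which decouples the scans of u and y.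
  Separated : ℤ → ℤ → Set
  Separated u y = u ≡ 0ℤ ⊎ ∃₂ λ k y′ → Fits k u × y ≡ + (p ^ (k + 1)) ℤ.* y′

  fits-0 : ∀ L → Fits L 0ℤ
  fits-0 L = z≤n

  private module _ (u : ℤ) (k : ℕ) (y′ : ℤ) (fits-u : Fits k u) where
    K = k + 1
    y = + (p ^ K) ℤ.* y′
    -- A common length: K + m digits are enough for y and for u + y.
    m = ℤ.∣ y′ ∣ + ℤ.∣ y ∣ + ℤ.∣ u ℤ.+ y ∣

    fits-K : Fits K u
    fits-K = fits-mono u (m≤m+n k 1) fits-u

    fits-y : Fits (K + m) y
    fits-y = fits-mono y
      (≤-trans (m≤n+m ℤ.∣ y ∣ ℤ.∣ y′ ∣) (≤-trans (m≤m+n _ _) (m≤n+m m K))) (fits-self y)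

    fits-u+y : Fits (K + m) (u ℤ.+ y)
    fits-u+y = fits-mono (u ℤ.+ y)
      (≤-trans (m≤n+m _ (ℤ.∣ y′ ∣ + ℤ.∣ y ∣)) (m≤n+m m K)) (fits-self (u ℤ.+ y))

    -- The extra position is read as a zero, which brings the state into the form that `scan-sync`
    -- and `count-sync` expect.
    scan-K : scan K u start ≡ (Top u , 𝟘)
    scan-K = begin
      scan (k + 1) u start                          ≡⟨ scan-pad k 1 u start fits-u ⟩
      step (δ 0ℤ) (scan k u start)
        ≡⟨ cong (λ d → step d (scan k u start)) (proj₁ δ-0) ⟩
      step 𝟘 (scan k u start)                       ≡⟨ step-𝟘 _ _ ⟩
      (proj₁ (scan k u start) , 𝟘)                  ≡⟨ cong (_, 𝟘) (Top-fits k u fits-u) ⟨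
      (Top u , 𝟘)                                   ∎
      where open ≡-Reasoning

    lowest-sum : lowest (K + m) (u ℤ.+ y) ≡ lowest K u orElse lowest m y′
    lowest-sum = lowest-++ K m u y′ fits-K

    scan-sum : scan (K + m) (u ℤ.+ y) start ≡ scan m y′ (Top u , 𝟘)
    scan-sum = trans (scan-++ K m u y′ start fits-K) (cong (scan m y′) scan-K)

    lowest-y : Lowest y ≡ lowest m y′
    lowest-y = begin
      Lowest y                                 ≡⟨ Lowest-fits (K + m) y fits-y ⟩
      lowest (K + m) y                         ≡⟨ cong (lowest (K + m)) (ℤₚ.+-identityˡ y) ⟨
      lowest (K + m) (0ℤ ℤ.+ y)                ≡⟨ lowest-++ K m 0ℤ y′ (fits-0 K) ⟩
      lowest K 0ℤ orElse lowest m y′           ≡⟨ cong (_orElse lowest m y′) (lowest-0 K) ⟩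
      𝟘 orElse lowest m y′                     ≡⟨ 𝟘-orElse (lowest m y′) ⟩
      lowest m y′                              ∎
      where open ≡-Reasoning

    scan-y : scan (K + m) y start ≡ scan m y′ start
    scan-y = begin
      scan (K + m) y start
        ≡⟨ cong (λ y → scan (K + m) y start) (ℤₚ.+-identityˡ y) ⟨
      scan (K + m) (0ℤ ℤ.+ y) start            ≡⟨ scan-++ K m 0ℤ y′ start (fits-0 K) ⟩
      scan m y′ (scan K 0ℤ start)              ≡⟨ cong (scan m y′) (scan-0 K (𝟘 , 𝟘)) ⟩
      scan m y′ start                          ∎
      where open ≡-Reasoning

    lowest-+ : Lowest (u ℤ.+ y) ≡ Lowest u orElse Lowest y
    lowest-+ = begin
      Lowest (u ℤ.+ y)                       ≡⟨ Lowest-fits (K + m) (u ℤ.+ y) fits-u+y ⟩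
      lowest (K + m) (u ℤ.+ y)               ≡⟨ lowest-sum ⟩
      lowest K u orElse lowest m y′          ≡⟨ cong₂ _orElse_ (Lowest-fits K u fits-K) lowest-y ⟨
      Lowest u orElse Lowest y               ∎
      where open ≡-Reasoning

    top-+ : y ≢ 0ℤ → Top (u ℤ.+ y) ≡ Top y
    top-+ y≢0 = begin
      Top (u ℤ.+ y)                              ≡⟨ Top-fits (K + m) (u ℤ.+ y) fits-u+y ⟩
      proj₁ (scan (K + m) (u ℤ.+ y) start)       ≡⟨ cong proj₁ scan-sum ⟩
      proj₁ (scan m y′ (Top u , 𝟘))
        ≡⟨ cong proj₁ (scan-sync m y′ (Top u) (𝟘 , 𝟘) (subst (_≢ 𝟘) lowest-y (Lowest-≢𝟘 y≢0))) ⟩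
      proj₁ (scan m y′ start)                    ≡⟨ cong proj₁ scan-y ⟨
      proj₁ (scan (K + m) y start)               ≡⟨ Top-fits (K + m) y fits-y ⟨
      Top y                                      ∎
      where open ≡-Reasoning

    module _ {T* v*} (T*≢𝟘 : T* ≢ (𝟘 , 𝟘)) (v*≢𝟘 : v* ≢ 𝟘) where
      open Counting T* v*
      open Properties T*≢𝟘 v*≢𝟘

      count-y : Count y ≡ count m y′ start
      count-y = begin
        Count y                                                 ≡⟨ Count-fits (K + m) y fits-y ⟩
        count (K + m) y start
          ≡⟨ cong (λ y → count (K + m) y start) (ℤₚ.+-identityˡ y) ⟨
        count (K + m) (0ℤ ℤ.+ y) start
          ≡⟨ count-++ K m 0ℤ y′ start (fits-0 K) ⟩
        count K 0ℤ start + count m y′ (scan K 0ℤ start)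
          ≡⟨ cong₂ (λ n s → n + count m y′ s) (count-0 K start) (scan-0 K (𝟘 , 𝟘)) ⟩
        count m y′ start                                        ∎
        where open ≡-Reasoning

      -- Besides the occurrences within u and within y there can be one across the border, formed by
      -- the top digits of u and the lowest nonzero digit of y.
      count-+ : Count (u ℤ.+ y) ≡ Count u + (hit (Top u) (Lowest y) + Count y)
      count-+ = begin
        Count (u ℤ.+ y)
          ≡⟨ Count-fits (K + m) (u ℤ.+ y) fits-u+y ⟩
        count (K + m) (u ℤ.+ y) start
          ≡⟨ count-++ K m u y′ start fits-K ⟩
        count K u start + count m y′ (scan K u start)
          ≡⟨ cong₂ (λ n s → n + count m y′ s) (sym (Count-fits K u fits-K)) scan-K ⟩
        Count u + count m y′ (Top u , 𝟘)
          ≡⟨ cong (λ n → Count u + n) (count-sync m y′ (Top u)) ⟩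
        Count u + (hit (Top u) (lowest m y′) + count m y′ start)
          ≡⟨ cong₂ (λ d n → Count u + (hit (Top u) d + n)) lowest-y count-y ⟨
        Count u + (hit (Top u) (Lowest y) + Count y)                 ∎
        where open ≡-Reasoning

  Lowest-+ : ∀ {u y} → Separated u y → Lowest (u ℤ.+ y) ≡ Lowest u orElse Lowest y
  Lowest-+ {y = y} (inj₁ refl) = trans (cong Lowest (ℤₚ.+-identityˡ y)) (sym (𝟘-orElse (Lowest y)))
  Lowest-+ {u} (inj₂ (k , y′ , fits , refl)) = lowest-+ u k y′ fits

  Top-+ : ∀ {u y} → Separated u y → y ≢ 0ℤ → Top (u ℤ.+ y) ≡ Top y
  Top-+ {y = y} (inj₁ refl) y≢0 = cong Top (ℤₚ.+-identityˡ y)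
  Top-+ {u} (inj₂ (k , y′ , fits , refl)) = top-+ u k y′ fits

  module _ {T* v*} (T*≢𝟘 : T* ≢ (𝟘 , 𝟘)) (v*≢𝟘 : v* ≢ 𝟘) where
    open Counting T* v*

    Count-+ : ∀ {u y} → Separated u y →
              Count (u ℤ.+ y) ≡ Count u + (hit (Top u) (Lowest y) + Count y)
    -- `Top 0ℤ` is (𝟘 , 𝟘), which differs from T*, so the border contributes 0.
    Count-+ {y = y} (inj₁ refl) = trans (cong Count (ℤₚ.+-identityˡ y))
      (cong (_+ Count y) (sym (hit-≢ˡ (Lowest y) (T*≢𝟘 ∘ sym))))
    Count-+ {u} (inj₂ (k , y′ , fits , refl)) = count-+ u k y′ fits T*≢𝟘 v*≢𝟘

  -- Lowest digits of multiples

  ⟦⟧-injective : ∀ {d e} → ⟦ d ⟧ ≡ ⟦ e ⟧ → d ≡ e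
  ⟦⟧-injective {d} {e} eq = proj₁ (⟦⟧-unique {w = 0ℤ} {v = 0ℤ} (cong (ℤ._+ P ℤ.* 0ℤ) eq))

  ⟦≢𝟘⟧ : ∀ {d} → d ≢ 𝟘 → ⟦ d ⟧ ≢ 0ℤ
  ⟦≢𝟘⟧ d≢𝟘 eq = d≢𝟘 (⟦⟧-injective (trans eq (sym ⟦𝟘⟧)))

  h<p : h < p
  h<p = subst (h <_) (sym p≡) (s≤s (m≤m+n h _))

  module _ (prime : Prime p) where

    -- Equal last digits mean that p divides (c - c′) ⟦ d ⟧. The prime p does not divide ⟦ d ⟧,
    -- which is nonzero and at most h in size, and it divides c - c′ only if this is 0.
    δ-*-injective : ∀ {c c′ d} → d ≢ 𝟘 → ℤ.∣ c ℤ.- c′ ∣ < p →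
                    δ (c ℤ.* ⟦ d ⟧) ≡ δ (c′ ℤ.* ⟦ d ⟧) → c ≡ c′
    δ-*-injective {c} {c′} {d} d≢𝟘 c-c′<p eq =
      [ (λ p∣c-c′ → ℤₚ.i-j≡0⇒i≡j c c′ (ℤₚ.∣i∣≡0⇒i≡0 (small c-c′<p p∣c-c′)))
      , (λ p∣d → contradiction (ℤₚ.∣i∣≡0⇒i≡0 (small (≤-<-trans ∣⟦ d ⟧∣≤h h<p) p∣d)) (⟦≢𝟘⟧ d≢𝟘))
      ]′ (euclidsLemma ℤ.∣ c ℤ.- c′ ∣ ℤ.∣ ⟦ d ⟧ ∣ prime p∣)
      where
      small : ∀ {n} → n < p → p ∣ n → n ≡ 0
      small {zero}  _   _   = refl
      small {suc n} n<p p∣n = contradiction p∣n (>⇒∤ n<p)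

      q = quot (c ℤ.* ⟦ d ⟧)
      q′ = quot (c′ ℤ.* ⟦ d ⟧)

      open ≡-Reasoning
      distrib : ∀ c c′ d → (c ℤ.- c′) ℤ.* d ≡ c ℤ.* d ℤ.- c′ ℤ.* d
      distrib = solve-∀
      cancel : ∀ e P q q′ → (e ℤ.+ P ℤ.* q) ℤ.- (e ℤ.+ P ℤ.* q′) ≡ P ℤ.* (q ℤ.- q′)
      cancel = solve-∀

      multiple : (c ℤ.- c′) ℤ.* ⟦ d ⟧ ≡ P ℤ.* (q ℤ.- q′)
      multiple = begin
        (c ℤ.- c′) ℤ.* ⟦ d ⟧                                           ≡⟨ distrib c c′ ⟦ d ⟧ ⟩
        c ℤ.* ⟦ d ⟧ ℤ.- c′ ℤ.* ⟦ d ⟧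
          ≡⟨ cong₂ ℤ._-_ (δ-quot (c ℤ.* ⟦ d ⟧)) (δ-quot (c′ ℤ.* ⟦ d ⟧)) ⟩
        (⟦ δ (c ℤ.* ⟦ d ⟧) ⟧ ℤ.+ P ℤ.* q) ℤ.- (⟦ δ (c′ ℤ.* ⟦ d ⟧) ⟧ ℤ.+ P ℤ.* q′)
          ≡⟨ cong (λ e → (⟦ e ⟧ ℤ.+ P ℤ.* q) ℤ.- (⟦ δ (c′ ℤ.* ⟦ d ⟧) ⟧ ℤ.+ P ℤ.* q′)) eq ⟩
        (⟦ δ (c′ ℤ.* ⟦ d ⟧) ⟧ ℤ.+ P ℤ.* q) ℤ.- (⟦ δ (c′ ℤ.* ⟦ d ⟧) ⟧ ℤ.+ P ℤ.* q′)
          ≡⟨ cancel ⟦ δ (c′ ℤ.* ⟦ d ⟧) ⟧ P q q′ ⟩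
        P ℤ.* (q ℤ.- q′)                                                ∎

      p∣ : p ∣ ℤ.∣ c ℤ.- c′ ∣ * ℤ.∣ ⟦ d ⟧ ∣
      p∣ = divides ℤ.∣ q ℤ.- q′ ∣ (begin
        ℤ.∣ c ℤ.- c′ ∣ * ℤ.∣ ⟦ d ⟧ ∣       ≡⟨ ℤₚ.abs-* (c ℤ.- c′) ⟦ d ⟧ ⟨
        ℤ.∣ (c ℤ.- c′) ℤ.* ⟦ d ⟧ ∣         ≡⟨ cong ℤ.∣_∣ multiple ⟩
        ℤ.∣ P ℤ.* (q ℤ.- q′) ∣             ≡⟨ ℤₚ.abs-* P (q ℤ.- q′) ⟩
        p * ℤ.∣ q ℤ.- q′ ∣                 ≡⟨ *-comm p _ ⟩
        ℤ.∣ q ℤ.- q′ ∣ * p                 ∎)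

    module _ {c : ℤ} (c≢0 : c ≢ 0ℤ) (∣c∣<p : ℤ.∣ c ∣ < p) where

      δ-*-≢𝟘 : ∀ {d} → d ≢ 𝟘 → δ (c ℤ.* ⟦ d ⟧) ≢ 𝟘
      δ-*-≢𝟘 {d} d≢𝟘 eq = c≢0 (δ-*-injective d≢𝟘
        (subst (_< p) (cong ℤ.∣_∣ (sym (ℤₚ.+-identityʳ c))) ∣c∣<p)
        (trans eq (sym (trans (cong δ (ℤₚ.*-zeroˡ ⟦ d ⟧)) (proj₁ δ-0)))))

      -- As c is no multiple of the prime p, z and c z end in equally many zeros. At the next
      -- position the digit of c z is determined by that of z modulo p.
      lowest-* : ∀ L z → lowest L (c ℤ.* z) ≡ δ (c ℤ.* ⟦ lowest L z ⟧)
      lowest-* zero    z =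
        sym (trans (cong (λ n → δ (c ℤ.* n)) ⟦𝟘⟧) (trans (cong δ (ℤₚ.*-zeroʳ c)) (proj₁ δ-0)))
      lowest-* (suc L) z = by (δ z) (quot z) (δ-quot z)
        where
        open ≡-Reasoning
        distrib : ∀ c d P q → c ℤ.* (d ℤ.+ P ℤ.* q) ≡ c ℤ.* d ℤ.+ P ℤ.* (c ℤ.* q)
        distrib = solve-∀

        cz≡ : ∀ d q → z ≡ ⟦ d ⟧ ℤ.+ P ℤ.* q → c ℤ.* z ≡ c ℤ.* ⟦ d ⟧ ℤ.+ P ℤ.* (c ℤ.* q)
        cz≡ d q eq = trans (cong (c ℤ.*_) eq) (distrib c ⟦ d ⟧ P q)

        by : ∀ d q → z ≡ ⟦ d ⟧ ℤ.+ P ℤ.* q →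
             lowest (suc L) (c ℤ.* z) ≡ δ (c ℤ.* ⟦ d orElse lowest L q ⟧)
        by d q eq with d Finₚ.≟ 𝟘
        ... | no d≢𝟘 = trans (cong (_orElse lowest L (quot (c ℤ.* z))) δcz≡)
                             (≢𝟘-orElse (lowest L (quot (c ℤ.* z))) (δ-*-≢𝟘 d≢𝟘))
          where
          δcz≡ : δ (c ℤ.* z) ≡ δ (c ℤ.* ⟦ d ⟧)
          δcz≡ = trans (cong δ (cz≡ d q eq)) (proj₁ (δ-quot-+ (c ℤ.* ⟦ d ⟧) (c ℤ.* q)))
        ... | yes d≡𝟘 = begin
          δ (c ℤ.* z) orElse lowest L (quot (c ℤ.* z))
            ≡⟨ cong₂ (λ d q → d orElse lowest L q) (proj₁ digit) (proj₂ digit) ⟩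
          𝟘 orElse lowest L (c ℤ.* q)                    ≡⟨ 𝟘-orElse (lowest L (c ℤ.* q)) ⟩
          lowest L (c ℤ.* q)                             ≡⟨ lowest-* L q ⟩
          δ (c ℤ.* ⟦ lowest L q ⟧)                       ∎
          where
          cz≡′ : ⟦ δ (c ℤ.* z) ⟧ ℤ.+ P ℤ.* quot (c ℤ.* z) ≡ ⟦ 𝟘 ⟧ ℤ.+ P ℤ.* (c ℤ.* q)
          cz≡′ = begin
            ⟦ δ (c ℤ.* z) ⟧ ℤ.+ P ℤ.* quot (c ℤ.* z)     ≡⟨ δ-quot (c ℤ.* z) ⟨
            c ℤ.* z                                      ≡⟨ cz≡ d q eq ⟩
            c ℤ.* ⟦ d ⟧ ℤ.+ P ℤ.* (c ℤ.* q)
              ≡⟨ cong (λ n → c ℤ.* n ℤ.+ P ℤ.* (c ℤ.* q)) (trans (cong ⟦_⟧ d≡𝟘) ⟦𝟘⟧) ⟩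
            c ℤ.* 0ℤ ℤ.+ P ℤ.* (c ℤ.* q)
              ≡⟨ cong (ℤ._+ P ℤ.* (c ℤ.* q)) (trans (ℤₚ.*-zeroʳ c) (sym ⟦𝟘⟧)) ⟩
            ⟦ 𝟘 ⟧ ℤ.+ P ℤ.* (c ℤ.* q)                    ∎
          digit : δ (c ℤ.* z) ≡ 𝟘 × quot (c ℤ.* z) ≡ c ℤ.* q
          digit = ⟦⟧-unique cz≡′

      Lowest-* : ∀ z → Lowest (c ℤ.* z) ≡ δ (c ℤ.* ⟦ Lowest z ⟧)
      Lowest-* z = begin
        Lowest (c ℤ.* z)
          ≡⟨ Lowest-fits L (c ℤ.* z) (fits-mono (c ℤ.* z) (m≤n+m _ ℤ.∣ z ∣) (fits-self (c ℤ.* z))) ⟩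
        lowest L (c ℤ.* z)              ≡⟨ lowest-* L z ⟩
        δ (c ℤ.* ⟦ lowest L z ⟧)
          ≡⟨ cong (λ d → δ (c ℤ.* ⟦ d ⟧))
               (Lowest-fits L z (fits-mono z (m≤m+n ℤ.∣ z ∣ _) (fits-self z))) ⟨
        δ (c ℤ.* ⟦ Lowest z ⟧)          ∎
        where
        open ≡-Reasoning
        L = ℤ.∣ z ∣ + ℤ.∣ c ℤ.* z ∣

  -- Leading digits of multiples

  lead : Digit × Digit → ℤ
  lead (d , e) = ⟦ d ⟧ ℤ.* P ℤ.+ ⟦ e ⟧

  -- The factor p in front of z makes room for the second digit of t when z has
  -- only one digit.
  Approx : ℤ → ℤ → Set
  Approx t z = ∃[ s ] (2 * ℤ.∣ P ℤ.* z ℤ.- t ℤ.* + (p ^ s) ∣ < p ^ s)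

  -- |lead| ≥ p - h, and 2 (p - h) = p + 1.
  lead-large : ∀ {d e} → d ≢ 𝟘 → p < 2 * ℤ.∣ lead (d , e) ∣
  lead-large {d} {e} d≢𝟘 = +-cancelʳ-< (2 * h) _ _ (begin-strict
    p + 2 * h                                    <⟨ +-monoʳ-< p (≤-reflexive (sym p≡)) ⟩
    p + p                                        ≡⟨ cong (λ n → p + n) (+-identityʳ p) ⟨
    2 * p                                        ≤⟨ *-monoʳ-≤ 2 p≤ ⟩
    2 * (ℤ.∣ lead (d , e) ∣ + h)                 ≡⟨ *-distribˡ-+ 2 ℤ.∣ lead (d , e) ∣ h ⟩
    2 * ℤ.∣ lead (d , e) ∣ + 2 * h               ∎)
    where
    open ≤-Reasoning
    lemma : ∀ d P e → d ℤ.* P ≡ d ℤ.* P ℤ.+ e ℤ.- e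
    lemma = solve-∀
    p≤ : p ≤ ℤ.∣ lead (d , e) ∣ + h
    p≤ = begin
      p                                          ≡⟨ *-identityˡ p ⟨
      1 * p
        ≤⟨ *-monoˡ-≤ p (n≢0⇒n>0 (⟦≢𝟘⟧ d≢𝟘 ∘ ℤₚ.∣i∣≡0⇒i≡0)) ⟩
      ℤ.∣ ⟦ d ⟧ ∣ * p                            ≡⟨ ℤₚ.abs-* ⟦ d ⟧ P ⟨
      ℤ.∣ ⟦ d ⟧ ℤ.* P ∣                          ≡⟨ cong ℤ.∣_∣ (lemma ⟦ d ⟧ P ⟦ e ⟧) ⟩
      ℤ.∣ lead (d , e) ℤ.- ⟦ e ⟧ ∣               ≤⟨ ℤₚ.∣i-j∣≤∣i∣+∣j∣ (lead (d , e)) ⟦ e ⟧ ⟩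
      ℤ.∣ lead (d , e) ∣ + ℤ.∣ ⟦ e ⟧ ∣           ≤⟨ +-monoʳ-≤ _ ∣⟦ e ⟧∣≤h ⟩
      ℤ.∣ lead (d , e) ∣ + h                     ∎

  Good : Digit × Digit → ℤ → Set
  Good t z = z ≡ 0ℤ ⊎ (Approx (lead t) z × p < 2 * ℤ.∣ lead t ∣)

  -- u is the part read so far, of length k, and e is its digit at position k - 1. The inequality,
  -- multiplied by p to avoid that exponent, says that the digits of u below e amount to less than
  -- half a unit of the position of e.
  scan-good : ∀ L k u z t e →
    2 * ℤ.∣ P ℤ.* u ℤ.- ⟦ e ⟧ ℤ.* + (p ^ k) ∣ < p ^ k → Good t u → Fits L z →
    Good (proj₁ (scan L z (t , e))) (u ℤ.+ + (p ^ k) ℤ.* z)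
  scan-good zero k u z t e close good fits = subst (Good t) (sym (trans
    (cong (λ z → u ℤ.+ + (p ^ k) ℤ.* z) (fits-zero z fits)) (+p^*0 k u))) good
  scan-good (suc L) k u z t e close good fits =
    subst (Good _) total (by (δ z) refl)
    where
    pᵏ = + (p ^ k)
    q = quot z
    u′ : Digit → ℤ
    u′ d = u ℤ.+ pᵏ ℤ.* ⟦ d ⟧

    p^suc : + (p ^ suc k) ≡ P ℤ.* pᵏ
    p^suc = ℤₚ.pos-* p (p ^ k)

    regroup : ∀ u a d P q → u ℤ.+ a ℤ.* d ℤ.+ P ℤ.* a ℤ.* q ≡ u ℤ.+ a ℤ.* (d ℤ.+ P ℤ.* q)
    regroup = solve-∀

    total : u′ (δ z) ℤ.+ + (p ^ suc k) ℤ.* q ≡ u ℤ.+ pᵏ ℤ.* z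
    total = begin
      u′ (δ z) ℤ.+ + (p ^ suc k) ℤ.* q     ≡⟨ cong (λ n → u′ (δ z) ℤ.+ n ℤ.* q) p^suc ⟩
      u′ (δ z) ℤ.+ P ℤ.* pᵏ ℤ.* q          ≡⟨ regroup u pᵏ ⟦ δ z ⟧ P q ⟩
      u ℤ.+ pᵏ ℤ.* (⟦ δ z ⟧ ℤ.+ P ℤ.* q)   ≡⟨ cong (λ z → u ℤ.+ pᵏ ℤ.* z) (δ-quot z) ⟨
      u ℤ.+ pᵏ ℤ.* z                       ∎
      where open ≡-Reasoning

    -- The rounding error at the next position is p u, whose size is bounded
    -- by the present one and by the digit e.
    close′ : ∀ d → 2 * ℤ.∣ P ℤ.* u′ d ℤ.- ⟦ d ⟧ ℤ.* + (p ^ suc k) ∣ < p ^ suc k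
    close′ d = begin-strict
      2 * ℤ.∣ P ℤ.* u′ d ℤ.- ⟦ d ⟧ ℤ.* + (p ^ suc k) ∣
        ≡⟨ cong (λ n → 2 * ℤ.∣ P ℤ.* u′ d ℤ.- ⟦ d ⟧ ℤ.* n ∣) p^suc ⟩
      2 * ℤ.∣ P ℤ.* u′ d ℤ.- ⟦ d ⟧ ℤ.* (P ℤ.* pᵏ) ∣
        ≡⟨ cong (λ n → 2 * ℤ.∣ n ∣) (lemma u pᵏ ⟦ d ⟧ P ⟦ e ⟧) ⟩
      2 * ℤ.∣ E ℤ.+ ⟦ e ⟧ ℤ.* pᵏ ∣
        ≤⟨ *-monoʳ-≤ 2 (ℤₚ.∣i+j∣≤∣i∣+∣j∣ E (⟦ e ⟧ ℤ.* pᵏ)) ⟩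
      2 * (ℤ.∣ E ∣ + ℤ.∣ ⟦ e ⟧ ℤ.* pᵏ ∣)                 ≡⟨ *-distribˡ-+ 2 ℤ.∣ E ∣ _ ⟩
      2 * ℤ.∣ E ∣ + 2 * ℤ.∣ ⟦ e ⟧ ℤ.* pᵏ ∣
        ≡⟨ cong (λ n → 2 * ℤ.∣ E ∣ + 2 * n) (ℤₚ.abs-* ⟦ e ⟧ pᵏ) ⟩
      2 * ℤ.∣ E ∣ + 2 * (ℤ.∣ ⟦ e ⟧ ∣ * p ^ k)
        <⟨ +-mono-<-≤ close (*-monoʳ-≤ 2 (*-monoˡ-≤ (p ^ k) ∣⟦ e ⟧∣≤h)) ⟩
      p ^ k + 2 * (h * p ^ k)
        ≡⟨ cong (λ n → p ^ k + n) (*-assoc 2 h (p ^ k)) ⟨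
      suc (2 * h) * p ^ k                                ≡⟨ cong (_* p ^ k) p≡ ⟨
      p ^ suc k                                          ∎
      where
      open ≤-Reasoning
      E = P ℤ.* u ℤ.- ⟦ e ⟧ ℤ.* pᵏ
      lemma : ∀ u a d P e → P ℤ.* (u ℤ.+ a ℤ.* d) ℤ.- d ℤ.* (P ℤ.* a)
                            ≡ P ℤ.* u ℤ.- e ℤ.* a ℤ.+ e ℤ.* a
      lemma = solve-∀

    u′≡u : ∀ {d} → d ≡ 𝟘 → u′ d ≡ u
    u′≡u d≡𝟘 = trans (cong (λ n → u ℤ.+ pᵏ ℤ.* n) (trans (cong ⟦_⟧ d≡𝟘) ⟦𝟘⟧)) (+p^*0 k u)

    by : ∀ d → δ z ≡ d →
         Good (proj₁ (scan L q (step d (t , e)))) (u′ d ℤ.+ + (p ^ suc k) ℤ.* q)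
    by d δz≡d with d Finₚ.≟ 𝟘
    ... | yes d≡𝟘 = scan-good L (suc k) (u′ d) q t 𝟘
      (subst (λ e → 2 * ℤ.∣ P ℤ.* u′ d ℤ.- ⟦ e ⟧ ℤ.* + (p ^ suc k) ∣ < p ^ suc k) d≡𝟘 (close′ d))
      (subst (Good t) (sym (u′≡u d≡𝟘)) good) (fits-quot L z fits)
    -- The pair (d , e) now approximates with s = k, and its error is the previous error of e, since
    -- p u′ - (d p + e) p^k = p u - e p^k.
    ... | no d≢𝟘  = scan-good L (suc k) (u′ d) q (d , e) d (close′ d)
      (inj₂ ((k , subst (λ n → 2 * ℤ.∣ n ∣ < p ^ k) (lemma u pᵏ ⟦ d ⟧ P ⟦ e ⟧) close)
            , lead-large d≢𝟘)) (fits-quot L z fits)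
      where
      lemma : ∀ u a d P e → P ℤ.* u ℤ.- e ℤ.* a ≡ P ℤ.* (u ℤ.+ a ℤ.* d) ℤ.- (d ℤ.* P ℤ.+ e) ℤ.* a
      lemma = solve-∀

  Top-approx : ∀ {z} → z ≢ 0ℤ → Approx (lead (Top z)) z × p < 2 * ℤ.∣ lead (Top z) ∣
  Top-approx {z} z≢0
    with scan-good ℤ.∣ z ∣ 0 0ℤ z (𝟘 , 𝟘) 𝟘 close (inj₁ refl) (fits-self z)
    where
    close : 2 * ℤ.∣ P ℤ.* 0ℤ ℤ.- ⟦ 𝟘 ⟧ ℤ.* 1ℤ ∣ < 1
    close = subst (λ n → 2 * ℤ.∣ n ∣ < 1)
      (sym (cong₂ (λ a b → a ℤ.- b ℤ.* 1ℤ) (ℤₚ.*-zeroʳ P) ⟦𝟘⟧)) z<s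
  ... | inj₁ z≡0   = contradiction (trans (sym (0+1*z z)) z≡0) z≢0
    where
    0+1*z : ∀ z → 0ℤ ℤ.+ 1ℤ ℤ.* z ≡ z
    0+1*z = solve-∀
  ... | inj₂ (approx , large) = subst (Approx (lead (Top z))) (0+1*z z) approx , large
    where
    0+1*z : ∀ z → 0ℤ ℤ.+ 1ℤ ℤ.* z ≡ z
    0+1*z = solve-∀

  Top-≢𝟘 : ∀ {z} → z ≢ 0ℤ → Top z ≢ (𝟘 , 𝟘)
  Top-≢𝟘 {z} z≢0 eq = <⇒≱ (proj₂ (Top-approx z≢0)) (subst (_≤ p)
    (sym (cong (λ t → 2 * ℤ.∣ t ∣) (trans (cong lead eq) lead-𝟘))) z≤n)
    where
    lead-𝟘 : lead (𝟘 , 𝟘) ≡ 0ℤ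
    lead-𝟘 = trans (cong₂ (λ a b → a ℤ.* P ℤ.+ b) ⟦𝟘⟧ ⟦𝟘⟧) refl

  private
    module Bounds {t z s} (close : 2 * ℤ.∣ P ℤ.* z ℤ.- t ℤ.* + (p ^ s) ∣ < p ^ s) where
      E = P ℤ.* z ℤ.- t ℤ.* + (p ^ s)

      upper : 2 * (p * ℤ.∣ z ∣) < 2 * (ℤ.∣ t ∣ * p ^ s) + p ^ s
      upper = begin-strict
        2 * (p * ℤ.∣ z ∣)                                  ≡⟨ cong (2 *_) (ℤₚ.abs-* P z) ⟨
        2 * ℤ.∣ P ℤ.* z ∣
          ≡⟨ cong (λ n → 2 * ℤ.∣ n ∣) (lemma (P ℤ.* z) (t ℤ.* + (p ^ s))) ⟩
        2 * ℤ.∣ t ℤ.* + (p ^ s) ℤ.+ E ∣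
          ≤⟨ *-monoʳ-≤ 2 (ℤₚ.∣i+j∣≤∣i∣+∣j∣ (t ℤ.* + (p ^ s)) E) ⟩
        2 * (ℤ.∣ t ℤ.* + (p ^ s) ∣ + ℤ.∣ E ∣)
          ≡⟨ *-distribˡ-+ 2 ℤ.∣ t ℤ.* + (p ^ s) ∣ _ ⟩
        2 * ℤ.∣ t ℤ.* + (p ^ s) ∣ + 2 * ℤ.∣ E ∣
          ≡⟨ cong (λ n → 2 * n + 2 * ℤ.∣ E ∣) (ℤₚ.abs-* t _) ⟩
        2 * (ℤ.∣ t ∣ * p ^ s) + 2 * ℤ.∣ E ∣                <⟨ +-monoʳ-< _ close ⟩
        2 * (ℤ.∣ t ∣ * p ^ s) + p ^ s                      ∎
        where
        open ≤-Reasoning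
        lemma : ∀ a b → a ≡ b ℤ.+ (a ℤ.- b)
        lemma = solve-∀

      lower : 2 * (ℤ.∣ t ∣ * p ^ s) < 2 * (p * ℤ.∣ z ∣) + p ^ s
      lower = begin-strict
        2 * (ℤ.∣ t ∣ * p ^ s)                              ≡⟨ cong (2 *_) (ℤₚ.abs-* t _) ⟨
        2 * ℤ.∣ t ℤ.* + (p ^ s) ∣
          ≡⟨ cong (λ n → 2 * ℤ.∣ n ∣) (lemma (P ℤ.* z) (t ℤ.* + (p ^ s))) ⟩
        2 * ℤ.∣ P ℤ.* z ℤ.- E ∣
          ≤⟨ *-monoʳ-≤ 2 (ℤₚ.∣i-j∣≤∣i∣+∣j∣ (P ℤ.* z) E) ⟩
        2 * (ℤ.∣ P ℤ.* z ∣ + ℤ.∣ E ∣)                      ≡⟨ *-distribˡ-+ 2 ℤ.∣ P ℤ.* z ∣ _ ⟩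
        2 * ℤ.∣ P ℤ.* z ∣ + 2 * ℤ.∣ E ∣
          ≡⟨ cong (λ n → 2 * n + 2 * ℤ.∣ E ∣) (ℤₚ.abs-* P z) ⟩
        2 * (p * ℤ.∣ z ∣) + 2 * ℤ.∣ E ∣                    <⟨ +-monoʳ-< _ close ⟩
        2 * (p * ℤ.∣ z ∣) + p ^ s                          ∎
        where
        open ≤-Reasoning
        lemma : ∀ a b → b ≡ a ℤ.- (a ℤ.- b)
        lemma = solve-∀

  -- Let T = 2 |t|. Then 2 p |z| < (T + 1) p^s and 2 p |z′| > (T - 1) p^s′. If s < s′, then |z′| ≤ h
  -- |z| yields p (T - 1) < h (T + 1), which is false since T > p = 2h + 1.
  exponent-≤ : ∀ {t z z′ s s′} → p < 2 * ℤ.∣ t ∣ → ℤ.∣ z′ ∣ ≤ h * ℤ.∣ z ∣ →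
    2 * ℤ.∣ P ℤ.* z ℤ.- t ℤ.* + (p ^ s) ∣ < p ^ s →
    2 * ℤ.∣ P ℤ.* z′ ℤ.- t ℤ.* + (p ^ s′) ∣ < p ^ s′ → s′ ≤ s
  exponent-≤ {t} {z} {z′} {s} {s′} p<T z′≤hz close close′ = ≮⇒≥ λ s<s′ →
    n≮n (p * T * p ^ s′) (begin-strict
      p * T * p ^ s′                                                 ≡⟨ lemma₁ p τ (p ^ s′) ⟩
      p * (2 * (τ * p ^ s′))
        <⟨ *-monoʳ-< p (Bounds.lower {t} {z′} {s′} close′) ⟩
      p * (2 * (p * ℤ.∣ z′ ∣) + p ^ s′)
        ≤⟨ *-monoʳ-≤ p (+-monoˡ-≤ (p ^ s′) (*-monoʳ-≤ 2 (*-monoʳ-≤ p z′≤hz))) ⟩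
      p * (2 * (p * (h * ℤ.∣ z ∣)) + p ^ s′)
        ≡⟨ lemma₂ p h ℤ.∣ z ∣ (p ^ s′) ⟩
      p * (h * (2 * (p * ℤ.∣ z ∣)) + p ^ s′)
        ≤⟨ *-monoʳ-≤ p (+-monoˡ-≤ (p ^ s′) (*-monoʳ-≤ h (<⇒≤ (Bounds.upper {t} {z} {s} close)))) ⟩
      p * (h * (2 * (τ * p ^ s) + p ^ s) + p ^ s′)
        ≡⟨ lemma₃ p h τ (p ^ s) (p ^ s′) ⟩
      h * suc T * (p ^ suc s) + p * p ^ s′
        ≤⟨ +-monoˡ-≤ (p * p ^ s′) (*-monoʳ-≤ (h * suc T) (^-monoʳ-≤ p s<s′)) ⟩
      h * suc T * p ^ s′ + p * p ^ s′
        ≡⟨ *-distribʳ-+ (p ^ s′) (h * suc T) p ⟨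
      (h * suc T + p) * p ^ s′                                       ≤⟨ *-monoˡ-≤ (p ^ s′) bound ⟩
      p * T * p ^ s′                                                 ∎)
    where
    open ≤-Reasoning
    open +-*-Solver
    τ = ℤ.∣ t ∣
    T = 2 * τ

    lemma₁ : ∀ p τ Q → p * (2 * τ) * Q ≡ p * (2 * (τ * Q))
    lemma₁ = solve 3 (λ p τ Q → p :* (con 2 :* τ) :* Q := p :* (con 2 :* (τ :* Q))) refl

    lemma₂ : ∀ p h a Q → p * (2 * (p * (h * a)) + Q) ≡ p * (h * (2 * (p * a)) + Q)
    lemma₂ = solve 4 (λ p h a Q →
      p :* (con 2 :* (p :* (h :* a)) :+ Q) := p :* (h :* (con 2 :* (p :* a)) :+ Q)) refl

    lemma₃ : ∀ p h τ R Q →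
      p * (h * (2 * (τ * R) + R) + Q) ≡ h * suc (2 * τ) * (p * R) + p * Q
    lemma₃ = solve 5 (λ p h τ R Q →
      p :* (h :* (con 2 :* (τ :* R) :+ R) :+ Q)
      := h :* (con 1 :+ con 2 :* τ) :* (p :* R) :+ p :* Q) refl

    lemma₄ : ∀ h T → h * T + (T + h * T) ≡ suc (2 * h) * T
    lemma₄ = solve 2 (λ h T → h :* T :+ (T :+ h :* T) := (con 1 :+ con 2 :* h) :* T) refl

    bound : h * suc T + p ≤ p * T
    bound = begin
      h * suc T + p            ≡⟨ cong (_+ p) (trans (*-suc h T) (+-comm h (h * T))) ⟩
      h * T + h + p            ≡⟨ +-assoc (h * T) h p ⟩
      h * T + (h + p)          ≡⟨ cong (λ n → h * T + n) (+-comm h p) ⟩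
      h * T + (p + h)
        ≤⟨ +-monoʳ-≤ (h * T) (+-mono-≤ (<⇒≤ p<T) (m≤m*n h T {{>-nonZero (≤-<-trans z≤n p<T)}})) ⟩
      h * T + (T + h * T)      ≡⟨ lemma₄ h T ⟩
      suc (2 * h) * T          ≡⟨ cong (_* T) p≡ ⟨
      p * T                    ∎

  -- Since |z| and |c z| differ by a factor less than p / 2, equality of the
  -- leading digits would force |(c − 1) z| to be small relative to |z|.
  Top-*-≢ : ∀ {c z} → c ≢ 0ℤ → c ≢ 1ℤ → ℤ.∣ c ∣ ≤ h → z ≢ 0ℤ → Top (c ℤ.* z) ≢ Top z
  Top-*-≢ {c} {z} c≢0 c≢1 ∣c∣≤h z≢0 Top≡ =
    let (s , close) , large = Top-approx z≢0
        (s′ , close′) , _ = Top-approx cz≢0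
        close″ = subst (λ t → 2 * ℤ.∣ P ℤ.* (c ℤ.* z) ℤ.- lead t ℤ.* + (p ^ s′) ∣ < p ^ s′)
                       Top≡ close′
        -- The two errors can be compared only at the same exponent. Both |c z| ≤ h |z| and |z| ≤ h
        -- |c z| hold.
        s′≡s = ≤-antisym (exponent-≤ {t} {z} {c ℤ.* z} {s} {s′} large cz≤ close close″)
                         (exponent-≤ {t} {c ℤ.* z} {z} {s′} {s} large z≤ close″ close)
    in impossible s large close
         (subst (λ s → 2 * ℤ.∣ P ℤ.* (c ℤ.* z) ℤ.- t ℤ.* + (p ^ s) ∣ < p ^ s) s′≡s close″)
    where
    t = lead (Top z)

    cz≢0 : c ℤ.* z ≢ 0ℤ
    cz≢0 = [ c≢0 , z≢0 ]′ ∘ ℤₚ.i*j≡0⇒i≡0∨j≡0 c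

    cz≤ : ℤ.∣ c ℤ.* z ∣ ≤ h * ℤ.∣ z ∣
    cz≤ = subst (_≤ h * ℤ.∣ z ∣) (sym (ℤₚ.abs-* c z)) (*-monoˡ-≤ ℤ.∣ z ∣ ∣c∣≤h)

    z≤ : ℤ.∣ z ∣ ≤ h * ℤ.∣ c ℤ.* z ∣
    z≤ = begin
      ℤ.∣ z ∣                    ≤⟨ m≤n*m ℤ.∣ z ∣ ℤ.∣ c ∣ {{≢-nonZero (c≢0 ∘ ℤₚ.∣i∣≡0⇒i≡0)}} ⟩
      ℤ.∣ c ∣ * ℤ.∣ z ∣          ≡⟨ ℤₚ.abs-* c z ⟨
      ℤ.∣ c ℤ.* z ∣              ≤⟨ m≤n*m ℤ.∣ c ℤ.* z ∣ h {{>-nonZero 0<h}} ⟩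
      h * ℤ.∣ c ℤ.* z ∣          ∎
      where open ≤-Reasoning

    impossible : ∀ s → p < 2 * ℤ.∣ t ∣ →
      2 * ℤ.∣ P ℤ.* z ℤ.- t ℤ.* + (p ^ s) ∣ < p ^ s →
      2 * ℤ.∣ P ℤ.* (c ℤ.* z) ℤ.- t ℤ.* + (p ^ s) ∣ < p ^ s → ⊥
    impossible s p<T close close′ =
      <-asym p<T (begin-strict
        2 * τ        <⟨ *-cancelʳ-< (p ^ s) (2 * τ) 3 2τ<3 ⟩
        3            ≤⟨ s≤s (*-monoʳ-≤ 2 0<h) ⟩
        suc (2 * h)  ≡⟨ p≡ ⟨
        p            ∎)
      where
      open ≤-Reasoning
      τ = ℤ.∣ t ∣
      E = P ℤ.* z ℤ.- t ℤ.* + (p ^ s)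
      E′ = P ℤ.* (c ℤ.* z) ℤ.- t ℤ.* + (p ^ s)

      lemma : ∀ P c z a → (c ℤ.- 1ℤ) ℤ.* (P ℤ.* z) ≡ (P ℤ.* (c ℤ.* z) ℤ.- a) ℤ.- (P ℤ.* z ℤ.- a)
      lemma = solve-∀

      pz≤ : p * ℤ.∣ z ∣ ≤ ℤ.∣ E′ ∣ + ℤ.∣ E ∣
      pz≤ = begin
        p * ℤ.∣ z ∣                           ≡⟨ ℤₚ.abs-* P z ⟨
        ℤ.∣ P ℤ.* z ∣
          ≤⟨ m≤n*m _ ℤ.∣ c ℤ.- 1ℤ ∣ {{≢-nonZero (c≢1 ∘ ℤₚ.i-j≡0⇒i≡j c 1ℤ ∘ ℤₚ.∣i∣≡0⇒i≡0)}} ⟩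
        ℤ.∣ c ℤ.- 1ℤ ∣ * ℤ.∣ P ℤ.* z ∣        ≡⟨ ℤₚ.abs-* (c ℤ.- 1ℤ) (P ℤ.* z) ⟨
        ℤ.∣ (c ℤ.- 1ℤ) ℤ.* (P ℤ.* z) ∣        ≡⟨ cong ℤ.∣_∣ (lemma P c z (t ℤ.* + (p ^ s))) ⟩
        ℤ.∣ E′ ℤ.- E ∣                        ≤⟨ ℤₚ.∣i-j∣≤∣i∣+∣j∣ E′ E ⟩
        ℤ.∣ E′ ∣ + ℤ.∣ E ∣                    ∎

      2τ<3 : 2 * τ * p ^ s < 3 * p ^ s
      2τ<3 = begin-strict
        2 * τ * p ^ s                            ≡⟨ *-assoc 2 τ (p ^ s) ⟩
        2 * (τ * p ^ s)                          <⟨ Bounds.lower {t} {z} {s} close ⟩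
        2 * (p * ℤ.∣ z ∣) + p ^ s                ≤⟨ +-monoˡ-≤ (p ^ s) (*-monoʳ-≤ 2 pz≤) ⟩
        2 * (ℤ.∣ E′ ∣ + ℤ.∣ E ∣) + p ^ s
          ≡⟨ cong (_+ p ^ s) (*-distribˡ-+ 2 ℤ.∣ E′ ∣ ℤ.∣ E ∣) ⟩
        2 * ℤ.∣ E′ ∣ + 2 * ℤ.∣ E ∣ + p ^ s
          ≤⟨ +-monoˡ-≤ (p ^ s) (+-mono-≤ (<⇒≤ close′) (<⇒≤ close)) ⟩
        p ^ s + p ^ s + p ^ s                    ≡⟨ three (p ^ s) ⟩
        3 * p ^ s                                ∎
        where
        three : ∀ a → a + a + a ≡ 3 * a
        three = solve 1 (λ a → a :+ a :+ a := con 3 :* a) refl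
          where
          open +-*-Solver

-- The colouring

%≡⇒∣ : ∀ k .{{_ : NonZero k}} {a b} → (a + b) % k ≡ a % k → k ∣ b
%≡⇒∣ k {a} {b} eq = ∣m+n∣m⇒∣n (subst (k ∣_) lemma (n∣m*n ((a + b) / k))) (n∣m*n (a / k))
  where
  open ≡-Reasoning
  lemma : (a + b) / k * k ≡ a / k * k + b
  lemma = +-cancelˡ-≡ (a % k) _ _ (begin
    a % k + (a + b) / k * k          ≡⟨ cong (_+ (a + b) / k * k) eq ⟨
    (a + b) % k + (a + b) / k * k    ≡⟨ m≡m%n+[m/n]*n (a + b) k ⟨
    a + b                            ≡⟨ cong (_+ b) (m≡m%n+[m/n]*n a k) ⟩
    a % k + a / k * k + b            ≡⟨ +-assoc (a % k) _ b ⟩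
    a % k + (a / k * k + b)          ∎)

module _ {p h : ℕ} (p≡ : p ≡ suc (2 * h)) (0<h : 0 < h) (prime-p : Prime p) where

  open Balanced p≡ 0<h
  private instance
    p≢0 : NonZero p
    p≢0 = subst NonZero (sym p≡) _

  private
    1<p : 1 < p
    1<p = nonTrivial⇒n>1 p {{prime⇒nonTrivial prime-p}}

    h+h<p : h + h < p
    h+h<p = subst (h + h <_) (sym p≡) (s≤s (≤-reflexive (cong (λ n → h + n) (sym (+-identityʳ h)))))

  -- Disjoint digits from rapidity

  log-p : ∀ {n} → 0 < n → ∃[ s ] (p ^ s ≤ n × n < p ^ suc s)
  log-p {n} 0<n = go n (n<p^n n)
    where
    n<p^n : ∀ n → n < p ^ n
    n<p^n zero    = z<s
    n<p^n (suc n) = begin-strict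
      suc n            ≤⟨ n<p^n n ⟩
      p ^ n            <⟨ ^-monoʳ-< p 1<p (n<1+n n) ⟩
      p ^ suc n        ∎
      where open ≤-Reasoning
    go : ∀ m → n < p ^ m → ∃[ s ] (p ^ s ≤ n × n < p ^ suc s)
    go zero    n<1 = contradiction 0<n (<⇒≱ n<1)
    go (suc m) n<  with p ^ m ≤? n
    ... | yes ≤n = m , ≤n , n<
    ... | no  ≰n = go m (≰⇒> ≰n)

  module _ (x : ℕ → ℕ⁺) where

    X : ℕ → ℤ
    X j = + value (x j)

    X≢0 : ∀ j → X j ≢ 0ℤ
    X≢0 j eq = value≢0 (x j) (ℤₚ.+-injective eq)

    private
      instance
        x≢0 : ∀ {j} → NonZero (value (x j))
        x≢0 {j} = ≢-nonZero (value≢0 (x j))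

    module _ (rapid : Rapid {ω} p x) {a : ℕ → ℤ} (∣a∣≤h : ∀ j → ℤ.∣ a j ∣ ≤ h) where

      -- With p^s ≤ x j < p^(s + 1) and 2 p |dot j| < p^k ≤ x j, the next partial sum satisfies 2 p
      -- |dot (suc j)| < p² x j < p^(s + 3), and `Rapid` makes p^(s + 8) divide x (suc j). The
      -- factor p reserves the zero digit that `Separated` asks for.
      gap : ∀ j → ∃[ k ] (2 * (p * ℤ.∣ dot j a x ∣) < p ^ k × p ^ k ∣ value (x j))
      gap zero    = 0 , subst (λ n → 2 * n < 1) (sym (*-zeroʳ p)) z<s , 1∣ _
      gap (suc j) with gap j | log-p (>-nonZero⁻¹ (value (x j)))
      ... | k , z< , p^k∣x | s , p^s≤x , x<p^1+s =
        s + 8 , bound , rapid j (suc j) refl s p^s≤x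
        where
        open ≤-Reasoning
        z = dot j a x
        v = value (x j)
        ∣z′∣≤ : ℤ.∣ dot (suc j) a x ∣ ≤ ℤ.∣ z ∣ + h * v
        ∣z′∣≤ = begin
          ℤ.∣ dot (suc j) a x ∣          ≡⟨ cong ℤ.∣_∣ (dot-suc j a x) ⟩
          ℤ.∣ z ℤ.+ a j ℤ.* + v ∣        ≤⟨ ℤₚ.∣i+j∣≤∣i∣+∣j∣ z (a j ℤ.* + v) ⟩
          ℤ.∣ z ∣ + ℤ.∣ a j ℤ.* + v ∣    ≡⟨ cong (λ n → ℤ.∣ z ∣ + n) (ℤₚ.abs-* (a j) (+ v)) ⟩
          ℤ.∣ z ∣ + ℤ.∣ a j ∣ * v        ≤⟨ +-monoʳ-≤ ℤ.∣ z ∣ (*-monoˡ-≤ v (∣a∣≤h j)) ⟩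
          ℤ.∣ z ∣ + h * v                ∎

        open +-*-Solver
        lemma₁ : ∀ p z h v → 2 * (p * (z + h * v)) ≡ 2 * (p * z) + p * (2 * h * v)
        lemma₁ = solve 4 (λ p z h v → con 2 :* (p :* (z :+ h :* v))
          := con 2 :* (p :* z) :+ p :* (con 2 :* h :* v)) refl
        lemma₂ : ∀ p h v → p * v + p * (2 * h * v) ≡ p * (suc (2 * h) * v)
        lemma₂ = solve 3 (λ p h v → p :* v :+ p :* (con 2 :* h :* v)
          := p :* ((con 1 :+ con 2 :* h) :* v)) refl

        bound : 2 * (p * ℤ.∣ dot (suc j) a x ∣) < p ^ (s + 8)
        bound = begin-strict
          2 * (p * ℤ.∣ dot (suc j) a x ∣)                ≤⟨ *-monoʳ-≤ 2 (*-monoʳ-≤ p ∣z′∣≤) ⟩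
          2 * (p * (ℤ.∣ z ∣ + h * v))                    ≡⟨ lemma₁ p ℤ.∣ z ∣ h v ⟩
          2 * (p * ℤ.∣ z ∣) + p * (2 * h * v)            ≤⟨ +-monoˡ-≤ _ (<⇒≤ z<) ⟩
          p ^ k + p * (2 * h * v)                        ≤⟨ +-monoˡ-≤ _ (∣⇒≤ p^k∣x) ⟩
          v + p * (2 * h * v)                            ≤⟨ +-monoˡ-≤ _ (m≤n*m v p) ⟩
          p * v + p * (2 * h * v)                        ≡⟨ lemma₂ p h v ⟩
          p * (suc (2 * h) * v)                          ≡⟨ cong (λ q → p * (q * v)) p≡ ⟨
          p * (p * v)                                    <⟨ *-monoʳ-< p (*-monoʳ-< p x<p^1+s) ⟩
          p * (p * p ^ suc s)
            ≤⟨ ^-monoʳ-≤ p (≤-trans (s≤s (s≤s (s≤s (m≤n+m s 5)))) (≤-reflexive (+-comm 8 s))) ⟩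
          p ^ (s + 8)                                    ∎

      separated : ∀ j c → Separated (dot j a x) (c ℤ.* X j)
      separated j c with gap j
      -- This is the case of the empty sum, where `gap` claims no divisibility of x 0: 2 p |z| < 1
      -- forces z = 0.
      ... | zero  , z< , _ = inj₁ (ℤₚ.∣i∣≡0⇒i≡0 (n<1⇒n≡0 (begin-strict
        ℤ.∣ z ∣              ≤⟨ m≤n*m ℤ.∣ z ∣ p ⟩
        p * ℤ.∣ z ∣          ≤⟨ m≤n*m (p * ℤ.∣ z ∣) 2 ⟩
        2 * (p * ℤ.∣ z ∣)    <⟨ z< ⟩
        1                    ∎)))
        where
        open ≤-Reasoning
        z = dot j a x
      ... | suc k , z< , divides q v≡ = inj₂ (k , c ℤ.* + q , fits , y≡)
        where
        z = dot j a x
        fits : Fits k z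
        fits = *-cancelˡ-≤ 2 (s≤s⁻¹ (*-cancelˡ-< p _ _ (begin-strict
          p * (2 * ℤ.∣ z ∣)           ≡⟨ *-assoc p 2 _ ⟨
          p * 2 * ℤ.∣ z ∣             ≡⟨ cong (_* ℤ.∣ z ∣) (*-comm p 2) ⟩
          2 * p * ℤ.∣ z ∣             ≡⟨ *-assoc 2 p _ ⟩
          2 * (p * ℤ.∣ z ∣)           <⟨ z< ⟩
          p * p ^ k                   ≡⟨ cong (p *_) (suc-2half k) ⟨
          p * suc (2 * half k)        ∎)))
          where open ≤-Reasoning
        swap : ∀ c a b → c ℤ.* (a ℤ.* b) ≡ b ℤ.* (c ℤ.* a)
        swap = solve-∀
        y≡ : c ℤ.* X j ≡ + (p ^ (k + 1)) ℤ.* (c ℤ.* + q)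
        y≡ = begin
          c ℤ.* X j                                 ≡⟨ cong (λ n → c ℤ.* + n) v≡ ⟩
          c ℤ.* + (q * p ^ suc k)                   ≡⟨ cong (c ℤ.*_) (ℤₚ.pos-* q (p ^ suc k)) ⟩
          c ℤ.* (+ q ℤ.* + (p ^ suc k))             ≡⟨ swap c (+ q) (+ (p ^ suc k)) ⟩
          + (p ^ suc k) ℤ.* (c ℤ.* + q)
            ≡⟨ cong (λ n → + (p ^ n) ℤ.* (c ℤ.* + q)) (+-comm 1 k) ⟩
          + (p ^ (k + 1)) ℤ.* (c ℤ.* + q)           ∎
          where open ≡-Reasoning

  -- Colours and monochromatic solutions

  module Colouring (r : ℕ → ℤ) (N : ℕ) (c* : ℤ) where

    coef : Fin (suc N) → ℤ
    coef Fin.zero    = 1ℤ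
    coef (Fin.suc i) = r (toℕ i)

    -- By `Lowest-*` this is the lowest nonzero digit of c* z. Written in terms of `Lowest z`, it
    -- visibly depends on the colour of z only.
    target : ℤ → Digit
    target z = δ (c* ℤ.* ⟦ Lowest z ⟧)

    -- The pattern is read off from z itself. Within a colour class it is constant, so `same-stats`
    -- can replace it by the fixed (T , v).
    Count : ℤ → ℤ → ℕ
    Count z = Counting.Count (Top z) (target z)

    -- The modulus N + 1 exceeds the number of borders in the sum for r, so a positive number of
    -- hits there is not congruent to 0.
    residue : ℤ → Fin (suc N) → Fin (suc N)
    residue z i = fromℕ< (m%n<n (Count z (coef i ℤ.* z)) (suc N))

    colour : ℤ → Fin (p * (p * p * suc N ^ suc N))
    colour z = combine (Lowest z)
      (combine (combine (proj₁ (Top z)) (proj₂ (Top z))) (funToFin (residue z)))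

    colour-injective : ∀ y z → colour y ≡ colour z →
      Lowest y ≡ Lowest z × Top y ≡ Top z ×
      (∀ i → Count y (coef i ℤ.* y) % suc N ≡ Count z (coef i ℤ.* z) % suc N)
    colour-injective y z eq =
      let lowest≡ , eq₁ = Finₚ.combine-injective _ _ _ _ eq
          top≡ , eq₂ = Finₚ.combine-injective _ _ _ _ eq₁
          d≡ , e≡ = Finₚ.combine-injective _ _ _ _ top≡
      in lowest≡ , cong₂ _,_ d≡ e≡ , λ i → Finₚ.fromℕ<-injective _ _ _ _ (begin
        residue y i                          ≡⟨ Finₚ.finToFun-funToFin (residue y) i ⟨
        finToFun (funToFin (residue y)) i    ≡⟨ cong (λ g → finToFun {suc N} g i) eq₂ ⟩
        finToFun (funToFin (residue z)) i    ≡⟨ Finₚ.finToFun-funToFin (residue z) i ⟩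
        residue z i                          ∎)
      where open ≡-Reasoning

    module _ (∣r∣≤h : ∀ j → ℤ.∣ r j ∣ ≤ h)
             (c*≢0 : c* ≢ 0ℤ) (c*≢1 : c* ≢ 1ℤ) (∣c*∣≤h : ℤ.∣ c* ∣ ≤ h)
             {x : ℕ → ℕ⁺} (rapid : Rapid {ω} p x)
             (X-same : ∀ j → colour (+ value (x j)) ≡ colour (+ value (x 0)))
             (pair-same : colour (+ value (x 0) ℤ.+ + value (x 1)) ≡ colour (+ value (x 0)))
             where

      private
        k = suc N

        ≤h⇒<p : ∀ {n} → n ≤ h → n < p
        ≤h⇒<p n≤h = ≤-<-trans n≤h h<p

        x′ : ℕ → ℤ
        x′ = X x

      T : Digit × Digit
      T = Top (x′ 0)

      ℓ : Digit
      ℓ = Lowest (x′ 0)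

      v : Digit
      v = target (x′ 0)

      open Counting T v using (hit; hit-yes; hit-≢ˡ; hit-≢ʳ; hit≤1) renaming (Count to #)

      ℓ≢𝟘 : ℓ ≢ 𝟘
      ℓ≢𝟘 = Lowest-≢𝟘 (X≢0 x 0)

      T≢𝟘 : T ≢ (𝟘 , 𝟘)
      T≢𝟘 = Top-≢𝟘 (X≢0 x 0)

      v≢𝟘 : v ≢ 𝟘
      v≢𝟘 = δ-*-≢𝟘 prime-p c*≢0 (≤h⇒<p ∣c*∣≤h) ℓ≢𝟘

      -- These are the last digits of c* ⟦ ℓ ⟧ and 1 ⟦ ℓ ⟧, and |c* - 1| ≤ 2h < p.
      v≢ℓ : v ≢ ℓ
      v≢ℓ v≡ℓ = c*≢1 (δ-*-injective prime-p ℓ≢𝟘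
        (≤-<-trans (ℤₚ.∣i-j∣≤∣i∣+∣j∣ c* 1ℤ) (≤-<-trans (+-mono-≤ ∣c*∣≤h 0<h) h+h<p))
        (trans v≡ℓ (sym (trans (cong δ (ℤₚ.*-identityˡ ⟦ ℓ ⟧)) δ⟦ℓ⟧))))
        where
        δ⟦ℓ⟧ : δ ⟦ ℓ ⟧ ≡ ℓ
        δ⟦ℓ⟧ = proj₁ (⟦⟧-unique (trans (sym (δ-quot ⟦ ℓ ⟧))
          (sym (trans (cong (λ n → ⟦ ℓ ⟧ ℤ.+ n) (ℤₚ.*-zeroʳ P)) (ℤₚ.+-identityʳ ⟦ ℓ ⟧)))))

      same-stats : ∀ z → colour z ≡ colour (x′ 0) →
        Lowest z ≡ ℓ × Top z ≡ T × (∀ i → # (coef i ℤ.* z) % k ≡ # (coef i ℤ.* x′ 0) % k)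
      same-stats z eq = let lowest≡ , top≡ , count≡ = colour-injective z (x′ 0) eq in
        lowest≡ , top≡ , λ i → trans
          (cong₂ (λ t d → Counting.Count t (δ (c* ℤ.* ⟦ d ⟧)) (coef i ℤ.* z) % k)
                 (sym top≡) (sym lowest≡))
          (count≡ i)

      Lowest-c*X : ∀ {c} → c ≢ 0ℤ → ℤ.∣ c ∣ ≤ h → ∀ j → Lowest (c ℤ.* x′ j) ≡ δ (c ℤ.* ⟦ ℓ ⟧)
      Lowest-c*X {c} c≢0 ∣c∣≤h j = trans (Lowest-* prime-p c≢0 (≤h⇒<p ∣c∣≤h) (x′ j))
        (cong (λ d → δ (c ℤ.* ⟦ d ⟧)) (proj₁ (same-stats (x′ j) (X-same j))))

      -- The pair (T , v) occurs only between a term with coefficient 1 and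
      -- one with coefficient c*.
      hit≡0 : ∀ {c} → c ≢ 0ℤ → ℤ.∣ c ∣ ≤ h → hit (Top (c ℤ.* x′ 0)) (Lowest (c ℤ.* x′ 1)) ≡ 0
      hit≡0 {c} c≢0 ∣c∣≤h with c ℤₚ.≟ 1ℤ
      ... | no c≢1 = hit-≢ˡ (Lowest (c ℤ.* x′ 1)) (Top-*-≢ c≢0 c≢1 ∣c∣≤h (X≢0 x 0))
      ... | yes refl = hit-≢ʳ (Top (1ℤ ℤ.* x′ 0)) λ eq → v≢ℓ (begin
        v                            ≡⟨ eq ⟨
        Lowest (1ℤ ℤ.* x′ 1)         ≡⟨ cong Lowest (ℤₚ.*-identityˡ (x′ 1)) ⟩
        Lowest (x′ 1)                ≡⟨ proj₁ (same-stats (x′ 1) (X-same 1)) ⟩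
        ℓ                            ∎)
        where open ≡-Reasoning

      ∣coef∣≤h : ∀ i → ℤ.∣ coef i ∣ ≤ h
      ∣coef∣≤h Fin.zero    = 0<h
      ∣coef∣≤h (Fin.suc i) = ∣r∣≤h (toℕ i)

      -- By `hit≡0` the count of c (x 0 + x 1) is the sum of those of c x 0 and c x 1. As it is also
      -- congruent to that of c x 0, the other summand is divisible by k.
      ∣#-coef*x₁ : ∀ i → coef i ≢ 0ℤ → k ∣ # (coef i ℤ.* x′ 1)
      ∣#-coef*x₁ i c≢0 = %≡⇒∣ k {# (coef i ℤ.* x′ 0)} (trans
        (cong (_% k) (sym expand-pair))
        (proj₂ (proj₂ (same-stats (x′ 0 ℤ.+ x′ 1) pair-same)) i))
        where
        open ≡-Reasoning
        c = coef i
        -- `separated` speaks of partial sums, so c x 0 is presented as one, with constant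
        -- coefficients c.
        dot₁ : dot 1 (λ _ → c) x ≡ c ℤ.* x′ 0
        dot₁ = ℤₚ.+-identityʳ (c ℤ.* x′ 0)
        sep : Separated (c ℤ.* x′ 0) (c ℤ.* x′ 1)
        sep = subst (λ u → Separated u (c ℤ.* x′ 1)) dot₁
          (separated x rapid {λ _ → c} (λ _ → ∣coef∣≤h i) 1 c)
        expand-pair : # (c ℤ.* (x′ 0 ℤ.+ x′ 1)) ≡ # (c ℤ.* x′ 0) + # (c ℤ.* x′ 1)
        expand-pair = begin
          # (c ℤ.* (x′ 0 ℤ.+ x′ 1))
            ≡⟨ cong # (ℤₚ.*-distribˡ-+ c (x′ 0) (x′ 1)) ⟩
          # (c ℤ.* x′ 0 ℤ.+ c ℤ.* x′ 1)                  ≡⟨ Count-+ T≢𝟘 v≢𝟘 sep ⟩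
          # (c ℤ.* x′ 0) + (hit (Top (c ℤ.* x′ 0)) (Lowest (c ℤ.* x′ 1)) + # (c ℤ.* x′ 1))
            ≡⟨ cong (λ n → # (c ℤ.* x′ 0) + (n + # (c ℤ.* x′ 1))) (hit≡0 c≢0 (∣coef∣≤h i)) ⟩
          # (c ℤ.* x′ 0) + # (c ℤ.* x′ 1)                ∎

      ∣#-same : ∀ i z → coef i ≢ 0ℤ → colour z ≡ colour (x′ 0) → k ∣ # (coef i ℤ.* z)
      ∣#-same i z c≢0 eq = m%n≡0⇒n∣m _ k (begin
        # (coef i ℤ.* z) % k       ≡⟨ proj₂ (proj₂ (same-stats z eq)) i ⟩
        # (coef i ℤ.* x′ 0) % k    ≡⟨ proj₂ (proj₂ (same-stats (x′ 1) (X-same 1))) i ⟨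
        # (coef i ℤ.* x′ 1) % k    ≡⟨ n∣m⇒m%n≡0 _ k (∣#-coef*x₁ i c≢0) ⟩
        0                          ∎)
        where open ≡-Reasoning

      ∣#-r*x : ∀ {j} → j < N → k ∣ # (r j ℤ.* x′ j)
      ∣#-r*x {j} j<N with r j ℤₚ.≟ 0ℤ
      ... | yes r≡0 = subst (λ z → k ∣ # z)
        (sym (trans (cong (ℤ._* x′ j) r≡0) (ℤₚ.*-zeroˡ (x′ j)))) (k ∣0)
      ... | no r≢0  = subst (λ i → k ∣ # (r i ℤ.* x′ j)) (Finₚ.toℕ-fromℕ< j<N)
        (∣#-same (Fin.suc (fromℕ< j<N)) (x′ j)
          (r≢0 ∘ trans (cong r (sym (Finₚ.toℕ-fromℕ< j<N)))) (X-same j))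

      z : ℕ → ℤ
      z j = dot j r x

      #-suc : ∀ j → # (z (suc j)) ≡
              # (z j) + (hit (Top (z j)) (Lowest (r j ℤ.* x′ j)) + # (r j ℤ.* x′ j))
      #-suc j = trans (cong # (dot-suc j r x)) (Count-+ T≢𝟘 v≢𝟘 (separated x rapid ∣r∣≤h j (r j)))

      Lowest-suc : ∀ j → Lowest (z (suc j)) ≡ Lowest (z j) orElse Lowest (r j ℤ.* x′ j)
      Lowest-suc j = trans (cong Lowest (dot-suc j r x))
        (Lowest-+ (separated x rapid ∣r∣≤h j (r j)))

      Top-suc : ∀ j → r j ≡ 1ℤ → Top (z (suc j)) ≡ T
      Top-suc j r≡1 = begin
        Top (z (suc j))                ≡⟨ cong Top (dot-suc j r x) ⟩
        Top (z j ℤ.+ r j ℤ.* x′ j)     ≡⟨ cong (λ y → Top (z j ℤ.+ y)) rx≡x ⟩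
        Top (z j ℤ.+ x′ j)
          ≡⟨ Top-+ (subst (Separated (z j)) rx≡x (separated x rapid ∣r∣≤h j (r j))) (X≢0 x j) ⟩
        Top (x′ j)                     ≡⟨ proj₁ (proj₂ (same-stats (x′ j) (X-same j))) ⟩
        T                              ∎
        where
        open ≡-Reasoning
        rx≡x : r j ℤ.* x′ j ≡ x′ j
        rx≡x = trans (cong (ℤ._* x′ j) r≡1) (ℤₚ.*-identityˡ (x′ j))

      Before : ℕ → Set
      Before j = z j ≡ 0ℤ ⊎ (Lowest (z j) ≡ ℓ × Top (z j) ≡ T × k ∣ # (z j))

      -- Each term with coefficient 1 starts with the digit ℓ, different from v, so no border is a
      -- hit, and it ends in T. Thus a nonempty sum looks like x 0.
      before : ∀ j → j ≤ N → (∀ i → i < j → r i ≡ 0ℤ ⊎ r i ≡ 1ℤ) → Before j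
      before zero    _   _   = inj₁ refl
      before (suc j) j<N 0/1
        with 0/1 j ≤-refl | before j (<⇒≤ j<N) (λ i i<j → 0/1 i (m<n⇒m<1+n i<j))
      ... | inj₁ r≡0 | bef =
        subst (λ u → u ≡ 0ℤ ⊎ (Lowest u ≡ ℓ × Top u ≡ T × k ∣ # u)) (sym z≡) bef
        where
        z≡ : z (suc j) ≡ z j
        z≡ = trans (dot-suc j r x) (trans
          (cong (λ c → z j ℤ.+ c ℤ.* x′ j) r≡0) (ℤₚ.+-identityʳ (z j)))
      ... | inj₂ r≡1 | bef = inj₂ (low bef , Top-suc j r≡1 , count bef)
        where
        low-x : Lowest (r j ℤ.* x′ j) ≡ ℓ
        low-x = trans (cong Lowest (trans (cong (ℤ._* x′ j) r≡1) (ℤₚ.*-identityˡ (x′ j))))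
                      (proj₁ (same-stats (x′ j) (X-same j)))

        low : Before j → Lowest (z (suc j)) ≡ ℓ
        low (inj₁ z≡0) = trans (Lowest-suc j) (trans
          (cong (λ u → Lowest u orElse Lowest (r j ℤ.* x′ j)) z≡0)
          (trans (𝟘-orElse (Lowest (r j ℤ.* x′ j))) low-x))
        low (inj₂ (low≡ , _)) = trans (Lowest-suc j) (trans
          (cong (_orElse Lowest (r j ℤ.* x′ j)) low≡) (≢𝟘-orElse (Lowest (r j ℤ.* x′ j)) ℓ≢𝟘))

        ∣#z : Before j → k ∣ # (z j)
        ∣#z (inj₁ z≡0) = subst (λ u → k ∣ # u) (sym z≡0) (k ∣0)
        ∣#z (inj₂ (_ , _ , k∣)) = k∣

        count : Before j → k ∣ # (z (suc j))
        count bef = subst (k ∣_) (sym (#-suc j)) (∣m∣n⇒∣m+n (∣#z bef)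
          (∣m∣n⇒∣m+n (subst (k ∣_) (sym (hit-≢ʳ (Top (z j))
                       (λ eq → v≢ℓ (trans (sym eq) low-x)))) (k ∣0))
                     (∣#-r*x j<N)))

      -- t counts the occurrences of (T , v) at the borders between the terms.
      After : ℕ → Set
      After j = Lowest (z j) ≡ v ⊎ ∃₂ λ t m → # (z j) ≡ t + m × k ∣ m × 1 ≤ t × t ≤ j

      -- If nothing precedes, the lowest digit of c* x j, namely v, becomes that of the sum.
      -- Otherwise the preceding sum ends in T, and the border is the first hit.
      at : ∀ {j} → j < N → r j ≡ c* → Before j → After (suc j)
      at {j} j<N refl (inj₁ z≡0) = inj₁ (begin
        Lowest (z (suc j))                            ≡⟨ Lowest-suc j ⟩
        Lowest (z j) orElse Lowest (r j ℤ.* x′ j)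
          ≡⟨ cong (λ u → Lowest u orElse Lowest (r j ℤ.* x′ j)) z≡0 ⟩
        𝟘 orElse Lowest (r j ℤ.* x′ j)                ≡⟨ 𝟘-orElse (Lowest (r j ℤ.* x′ j)) ⟩
        Lowest (r j ℤ.* x′ j)                         ≡⟨ Lowest-c*X c*≢0 ∣c*∣≤h j ⟩
        v                                             ∎)
        where open ≡-Reasoning
      at {j} j<N refl (inj₂ (_ , top≡ , k∣)) = inj₂ (1 , # (z j) + # (r j ℤ.* x′ j) , (begin
        # (z (suc j))                                                             ≡⟨ #-suc j ⟩
        # (z j) + (hit (Top (z j)) (Lowest (r j ℤ.* x′ j)) + # (r j ℤ.* x′ j))
          ≡⟨ cong (λ n → # (z j) + (n + # (r j ℤ.* x′ j)))
                  (hit-yes top≡ (Lowest-c*X c*≢0 ∣c*∣≤h j)) ⟩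
        # (z j) + suc (# (r j ℤ.* x′ j))
          ≡⟨ +-suc (# (z j)) _ ⟩
        1 + (# (z j) + # (r j ℤ.* x′ j))                                          ∎)
        , ∣m∣n⇒∣m+n k∣ (∣#-r*x j<N) , ≤-refl , s≤s z≤n)
        where open ≡-Reasoning

      -- A further term leaves the lowest digit alone, adds a multiple of k from within, and at most
      -- one hit at its border.
      after-suc : ∀ {j} → j < N → After j → After (suc j)
      after-suc {j} j<N (inj₁ low≡v) = inj₁ (trans (Lowest-suc j) (trans
        (cong (_orElse Lowest (r j ℤ.* x′ j)) low≡v) (≢𝟘-orElse (Lowest (r j ℤ.* x′ j)) v≢𝟘)))
      after-suc {j} j<N (inj₂ (t , m , eq , k∣m , 1≤t , t≤j)) =
        inj₂ (t + b , m + # (r j ℤ.* x′ j)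
          , trans (#-suc j) (trans
              (cong (_+ (b + # (r j ℤ.* x′ j))) eq) (interchange t m b _))
          , ∣m∣n⇒∣m+n k∣m (∣#-r*x j<N) , ≤-trans 1≤t (m≤m+n t b)
          , ≤-trans (+-mono-≤ t≤j (hit≤1 (Top (z j)) (Lowest (r j ℤ.* x′ j))))
                    (≤-reflexive (+-comm j 1)))
        where
        b = hit (Top (z j)) (Lowest (r j ℤ.* x′ j))
        open +-*-Solver
        interchange : ∀ t m b n → t + m + (b + n) ≡ t + b + (m + n)
        interchange = solve 4 (λ t m b n → t :+ m :+ (b :+ n) := t :+ b :+ (m :+ n)) refl

      after : ∀ {i} j → i ≤′ j → j ≤ N → After i → After j
      after j ≤′-refl          _   aft = aft
      after (suc j) (≤′-step i≤j) j<N aft = after-suc j<N (after j i≤j (<⇒≤ j<N) aft)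

      impossible : ∀ {j} → j < N → r j ≡ c* → (∀ i → i < j → r i ≡ 0ℤ ⊎ r i ≡ 1ℤ) →
                   colour (z N) ≡ colour (x′ 0) → ⊥
      impossible {j} j<N r≡c* 0/1 eq = final (after N (≤⇒≤′ j<N) ≤-refl
        (at j<N r≡c* (before j (<⇒≤ j<N) 0/1)))
        where
        final : After N → ⊥
        final (inj₁ low≡v) = v≢ℓ (trans (sym low≡v) (proj₁ (same-stats (z N) eq)))
        -- `coef` is 1 at index zero, so k divides the count of z N itself and hence t; but 1 ≤ t ≤
        -- N < k.
        final (inj₂ (t , m , #≡ , k∣m , 1≤t , t≤N)) = >⇒∤ {{>-nonZero 1≤t}} (s≤s t≤N)
          (∣m+n∣m⇒∣n (subst (k ∣_) (trans #≡ (+-comm t m)) k∣#) k∣m)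
          where
          k∣# : k ∣ # (z N)
          k∣# = subst (λ u → k ∣ # u) (ℤₚ.*-identityˡ (z N)) (∣#-same Fin.zero (z N) (λ ()) eq)

-- Irregularity of the extended matrix

ZeroOne : ℤ → Set
ZeroOne i = i ≡ 0ℤ ⊎ i ≡ 1ℤ

zeroOne? : ∀ i → ZeroOne i ⊎ ¬ ZeroOne i
zeroOne? i with i ℤₚ.≟ 0ℤ | i ℤₚ.≟ 1ℤ
... | yes i≡0 | _       = inj₁ (inj₁ i≡0)
... | no _    | yes i≡1 = inj₁ (inj₂ i≡1)
... | no i≢0  | no i≢1  = inj₂ [ i≢0 , i≢1 ]′

zeroOne-abs : ∀ {i} → ZeroOne i → ℤ.∣ i ∣ < 2 × i ≡ + ℤ.∣ i ∣
zeroOne-abs (inj₁ refl) = z<s , refl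
zeroOne-abs (inj₂ refl) = ≤-refl , refl

Irregular : (ℕ → ℤ) → Set
Irregular r = (fs : FinitelyNonzero 0ℤ {ω} r) →
  ¬ RapidlyImagePartitionRegular {ω} {ω} (adjoin (integerRow r fs) F)

-- The image would contain the entry 0, which is not in `ℕ⁺`; any colouring and any prime show this.
zero-irregular : ∀ {r} → (∀ j → r j ≡ 0ℤ) → Irregular r
zero-irregular {r} r≡0 fs@(N , vanishes) regular =
  let x , (_ , rows) , _ = regular 1 (λ _ → Fin.zero) 2 prime[2]
      n , eq , _ = rows 0
      +n≡0 = fromℤ-injective {+ value n} {0ℤ} (trans (sym eq)
        (trans (integerRow-· r N vanishes x)
               (cong fromℤ (trans (dot-cong N x r≡0) (dot-0 N x)))))
  in value≢0 n (ℤₚ.+-injective +n≡0)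

module Outside
  {p h : ℕ} (p≡ : p ≡ suc (2 * h)) (0<h : 0 < h) (prime-p : Prime p)
  (r : ℕ → ℤ) (N : ℕ) (r≡0 : ∀ j → N ≤ j → r j ≡ 0ℤ) (c* : ℤ)
  (x : ℕ → ℕ⁺) (c : Fin _)
  (mono : ∀ i → ∃[ n ] (adjoin (integerRow {ω} r (N , r≡0)) F i · x ≡ fromℕ⁺ n
                        × Colouring.colour p≡ 0<h prime-p r N c* (+ value n) ≡ c))
  where

  open Colouring p≡ 0<h prime-p r N c*

  colour-of : ∀ i z → adjoin (integerRow r (N , r≡0)) F i · x ≡ fromℤ z → colour z ≡ c
  colour-of i z eq =
    let n , eq′ , χ≡ = mono i
    in trans (cong colour (fromℤ-injective {z} {+ value n} (trans (sym eq) eq′))) χ≡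

  F-colour : ∀ i z → F i · x ≡ fromℤ z → colour z ≡ c
  F-colour i = colour-of (suc i)

  X-colour : ∀ j → colour (+ value (x j)) ≡ c
  X-colour j = let i , eq = F-single j in F-colour i (+ value (x j)) (eq x)

  X-same : ∀ j → colour (+ value (x j)) ≡ colour (+ value (x 0))
  X-same j = trans (X-colour j) (sym (X-colour 0))

  pair-same : colour (+ value (x 0) ℤ.+ + value (x 1)) ≡ colour (+ value (x 0))
  pair-same = trans (F-colour 2 (+ value (x 0) ℤ.+ + value (x 1)) (F-pair x)) (sym (X-colour 0))

  full-same : colour (dot N r x) ≡ colour (+ value (x 0))
  full-same = trans (colour-of 0 (dot N r x) (integerRow-· r N r≡0 x)) (sym (X-colour 0))

outside-irregular : ∀ {p h} (p≡ : p ≡ suc (2 * h)) → 0 < h → Prime p →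
  ∀ {r} → (∀ j → ℤ.∣ r j ∣ ≤ h) →
  ∀ {j} (fs@(N , _) : FinitelyNonzero 0ℤ {ω} r) → j < N →
  ¬ ZeroOne (r j) → (∀ i → i < j → ZeroOne (r i)) →
  ¬ RapidlyImagePartitionRegular {ω} {ω} (adjoin (integerRow r fs) F)
outside-irregular {p} p≡ 0<h prime-p {r} ∣r∣≤h {j} (N , r≡0) j<N ¬0/1 before regular =
  let x , (c , mono) , rapid =
        regular _ (λ n → Colouring.colour p≡ 0<h prime-p r N (r j) (+ value n)) p prime-p
      module O = Outside p≡ 0<h prime-p r N r≡0 (r j) x c mono
  in Colouring.impossible p≡ 0<h prime-p r N (r j) ∣r∣≤h (¬0/1 ∘ inj₁) (¬0/1 ∘ inj₂) (∣r∣≤h j)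
       rapid O.X-same O.pair-same j<N refl before O.full-same

irregular : ∀ r → ¬ (∃[ i ] (∀ j → r j ≡ + f i j)) → Irregular r
irregular r ¬row fs@(N , r≡0) =
  [ (λ before → zero-irregular (all-0/1⇒0 (0/1 before)) fs)
  , (λ (j , j<N , ¬0/1 , before) →
      let B , ∣r∣≤B = bounded N r r≡0
          -- Rapid regularity is assumed for every prime, so p may depend on r: its half h is chosen
          -- above all |r j|.
          h , p , p≡ , prime-p , B<h = large-odd-prime B
      in outside-irregular {p} {h} p≡ (≤-trans (s≤s z≤n) B<h) prime-p
           (λ j → ≤-trans (∣r∣≤B j) (<⇒≤ B<h)) fs j<N ¬0/1 before)
  ]′ (all-or-first-failure (λ j → zeroOne? (r j)) N)
  where
  0/1 : (∀ j → j < N → ZeroOne (r j)) → ∀ j → ZeroOne (r j)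
  0/1 before j with j <? N
  ... | yes j<N = before j j<N
  ... | no j≮N  = inj₁ (r≡0 j (≮⇒≥ j≮N))

  -- By `zero-or-row` a finitely supported 0/1 sequence other than zero is a row of F, which `¬row`
  -- rules out.
  all-0/1⇒0 : (∀ j → ZeroOne (r j)) → ∀ j → r j ≡ 0ℤ
  all-0/1⇒0 0/1
    with zero-or-row N (λ j → ℤ.∣ r j ∣) (λ j → proj₁ (zeroOne-abs (0/1 j)))
           (λ j N≤j → cong ℤ.∣_∣ (r≡0 j N≤j))
  ... | inj₁ ∣r∣≡0    = λ j → ℤₚ.∣i∣≡0⇒i≡0 (∣r∣≡0 j)
  ... | inj₂ (i , f≗) = contradiction
    (i , λ j → trans (proj₂ (zeroOne-abs (0/1 j))) (cong +_ (sym (f≗ j)))) ¬row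

theorem4p5 : ExcludedMiddle 0ℓ →
    RapidlyImagePartitionRegular {ω} {ω} F
    × ((r : ℕ → ℤ) (fs : FinitelyNonzero 0ℤ {ω} r) →
    ¬ (∃[ i ] (∀ j → r j ≡ + f i j)) →
    ¬ RapidlyImagePartitionRegular {ω} {ω} (adjoin (integerRow r fs) F))
theorem4p5 em = F-rapid em , λ r fs ¬row → irregular r ¬row fs
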